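{- Let $T$ be a tournament with vertices $v_1,\dots,v_n$, $n>3$, and let $ET$ be the extended tournament obtained by blowing up $v_i$ into an independent set $I_i$ of size $s_i\ge1$, where at least one $s_i$ is even. Then $\chi'_{\mathrm{wo}}(ET)=3$ if $ET$ is bad, and $\chi'_{\mathrm{wo}}(ET)\le 2$ otherwise.
   Context: A tournament is an orientation of a complete graph. Given a tournament $T$ with vertices $v_1,\dots,v_n$ and integers $s_1,\dots,s_n\ge 1$, the extended tournament $ET$ has vertex set $I_1\cup\dots\cup I_n$ (disjoint sets, $|I_i|=s_i$, each $I_i$ independent), and for $x\in I_i$, $y\in I_j$ ($i\ne j$) there is an arc $xy$ iff $v_iv_j\in A(T)$. The extended tournament $ET$ with $n>3$ is called bad if all of the following hold: (a) $|V(ET)|=s_1+\dots+s_n$ is odd; (b) exactly one $s_j$ is even; (c) for this $j$, every vertex of $N_T^+(v_j)$ dominates (has an arc to) every vertex of $N_T^-(v_j)$; (d) $|N_T^-(v_j)|=1$ or $|N_T^+(v_j)|=1$. Here $N_T^+(v)$, $N_T^-(v)$ are the out- and in-neighbourhoods in $T$. For a vertex $v$ of a digraph $D$, the semi-cuts of $v$ are $\partial^+(v)$ (arcs leaving $v$) and $\partial^-(v)$ (arcs entering $v$). A map $\varphi:A(D)\to[k]=\{1,\dots,k\}$ satisfies condition (WO) at $v$ if there is a color $i\in[k]$ such that every nonempty semi-cut of $v$ contains an odd number of arcs of color $i$ (vacuous if both are empty). A weak-odd $k$-edge coloring is such a map satisfying (WO) at every vertex, and $\chi'_{\mathrm{wo}}(D)$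 is the least $k\ge0$ for which one exists. -}

module Defs where

open import Data.Nat using (ℕ; zero; suc; _+_; _%_; _≤_; _<_)
open import Data.Fin using (Fin; zero; suc; _≟_)
open import Data.Bool using (Bool; true; false; not; if_then_else_)
open import Data.Product using (Σ; _×_; _,_; proj₁; proj₂; ∃; ∃-syntax)
open import Data.Sum using (_⊎_)
open import Relation.Nullary using (¬_; yes; no)
open import Relation.Binary.PropositionalEquality using (_≡_; _≢_)

Even : ℕ → Set
Even m = m % 2 ≡ 0

Odd : ℕ → Set
Odd m = m % 2 ≡ 1

sumFin : ∀ {n} → (Fin n → ℕ) → ℕ
sumFin {zero}  f = 0
sumFin {suc n} f = f zero + sumFin (λ i → f (suc i))

countFin : ∀ {n} → (Fin n → Bool) → ℕ
countFin p = sumFin (λ i → if p i then 1 else 0)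

-- A tournament on vertex set Fin n: T i j ≡ true means the arc v_i v_j.
IsTournament : ∀ {n} → (Fin n → Fin n → Bool) → Set
IsTournament {n} T =
  (∀ i → T i i ≡ false) × (∀ i j → i ≢ j → T i j ≡ not (T j i))

EV : ∀ {n} → (Fin n → ℕ) → Set
EV s = Σ (Fin _) (λ i → Fin (s i))

EArc : ∀ {n} → (Fin n → Fin n → Bool) → (Fin n → ℕ) → Set
EArc T s = Σ (EV s) λ x → Σ (EV s) λ y → T (proj₁ x) (proj₁ y) ≡ true

sumEV : ∀ {n} (s : Fin n → ℕ) → (EV s → ℕ) → ℕ
sumEV s f = sumFin (λ j → sumFin (λ b → f (j , b)))

arcColInd : ∀ {n k} (T : Fin n → Fin n → Bool) (s : Fin n → ℕ)
  → (EArc T s → Fin k) → EV s → EV s → Fin k → ℕ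
arcColInd T s φ x y c with T (proj₁ x) (proj₁ y) in eq
... | true with φ (x , y , eq) ≟ c
...   | yes _ = 1
...   | no  _ = 0
arcColInd T s φ x y c | false = 0

arcInd : ∀ {n} (T : Fin n → Fin n → Bool) (s : Fin n → ℕ) → EV s → EV s → ℕ
arcInd T s x y = if T (proj₁ x) (proj₁ y) then 1 else 0

outDeg inDeg : ∀ {n} (T : Fin n → Fin n → Bool) (s : Fin n → ℕ) → EV s → ℕ
outDeg T s v = sumEV s (λ y → arcInd T s v y)
inDeg  T s v = sumEV s (λ x → arcInd T s x v)

outCol inCol : ∀ {n k} (T : Fin n → Fin n → Bool) (s : Fin n → ℕ)
  → (EArc T s → Fin k) → EV s → Fin k → ℕ
outCol T s φ v c = sumEV s (λ y → arcColInd T s φ v y c)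
inCol  T s φ v c = sumEV s (λ x → arcColInd T s φ x v c)

WO : ∀ {n k} (T : Fin n → Fin n → Bool) (s : Fin n → ℕ)
  → (EArc T s → Fin k) → EV s → Set
WO T s φ v =
  (outDeg T s v ≡ 0 × inDeg T s v ≡ 0)
  ⊎ (∃[ c ] ((outDeg T s v ≢ 0 → Odd (outCol T s φ v c))
           × (inDeg T s v ≢ 0 → Odd (inCol T s φ v c))))

IsWeakOddColoring : ∀ {n k} (T : Fin n → Fin n → Bool) (s : Fin n → ℕ)
  → (EArc T s → Fin k) → Set
IsWeakOddColoring T s φ = ∀ v → WO T s φ v

HasWeakOddColoring : ∀ {n} (T : Fin n → Fin n → Bool) (s : Fin n → ℕ) → ℕ → Set
HasWeakOddColoring T s k = Σ (EArc T s → Fin k) (IsWeakOddColoring T s)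

χwo≡ : ∀ {n} (T : Fin n → Fin n → Bool) (s : Fin n → ℕ) → ℕ → Set
χwo≡ T s m = HasWeakOddColoring T s m × (∀ k → k < m → ¬ HasWeakOddColoring T s k)

χwo≤ : ∀ {n} (T : Fin n → Fin n → Bool) (s : Fin n → ℕ) → ℕ → Set
χwo≤ T s m = ∃[ k ] (k ≤ m × HasWeakOddColoring T s k)

outNb inNb : ∀ {n} → (Fin n → Fin n → Bool) → Fin n → ℕ
outNb T j = countFin (λ i → T j i)
inNb  T j = countFin (λ i → T i j)

-- ET is bad (n > 3 is the theorem's standing hypothesis, included here too)
Bad : ∀ {n} (T : Fin n → Fin n → Bool) (s : Fin n → ℕ) → Set
Bad {n} T s =
  3 < n
  × Odd (sumFin s)
  × ∃[ j ] ( Even (s j)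
           × (∀ i → i ≢ j → Odd (s i))
           × (∀ u w → T j u ≡ true → T w j ≡ true → T u w ≡ true)
           × (inNb T j ≡ 1 ⊎ outNb T j ≡ 1))

{-# OPTIONS --safe #-}

-- Over the field with two elements, a weak-odd 2-edge coloring is a solution of a linear system.
-- The first color class F has out- and in-degree parities (1 , 1) at v, or these shifted by the
-- degree parities (d⁺ v , d⁻ v) when v is satisfied by the second color.  By the Fredholm
-- alternative, either F exists or there are A , B : V → 𝔽₂ with A u = B v on every arc uv,
-- A d⁺ = B d⁻ at every vertex, A and B zero on empty semi-cuts, and Σ A + Σ B = 1.  Such A and B
-- are constant on the classes I_i.  At most one class x has (A , B) = (1 , 0), at most one class y
-- has (0 , 1), and the other classes agree on a common pair (1 , 1) or (0 , 0).  Going through the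
-- cases, only y → x → w → y for all other w is possible, with exactly one of x and y even and
-- everything else odd, that is, a bad extended tournament; conversely bad ones have such A and B.
-- For the third color, deleting one vertex p of the even class makes all classes odd, and then the
-- same alternative gives F on the remaining arcs with all parities (1 , 1); two further colors
-- satisfy p.
module Submission where

open import Defs
open import Algebra.Bundles using (CommutativeRing)
open import Data.Bool using (Bool; true; false; not; _∧_; _xor_; if_then_else_)
open import Data.Bool.Properties using
  ( ∧-comm; ∧-assoc; ∧-zeroʳ; ∧-identityʳ; ∧-distribˡ-xor; ∧-distribʳ-xor; xor-comm; xor-same
  ; xor-identityʳ; not-involutive; not-distribˡ-xor; ¬-not; xor-∧-commutativeRing)
open import Data.Bool.Solver using (module xor-∧-Solver)
open import Data.Fin using (Fin; zero; suc; _≟_; fromℕ<; inject≤; punchIn; punchOut)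
open import Data.Fin.Properties using
  ( any?; inject≤-injective; punchInᵢ≢i; punchIn-injective; punchIn-punchOut; suc-injective)
open import Data.List using (List; []; _∷_; _++_; map; concat; tabulate; cartesianProduct)
open import Data.List.Membership.Propositional using (_∈_)
open import Data.List.Membership.Propositional.Properties using
  ( ∈-map⁺; ∈-map⁻; ∈-++⁺ˡ; ∈-++⁺ʳ; ∈-concat⁺′; ∈-tabulate⁺; ∈-cartesianProduct⁺)
open import Data.List.Relation.Unary.All using (All; []; _∷_)
import Data.List.Relation.Unary.All as All
open import Data.List.Relation.Unary.Any using (here; there)
open import Data.Nat using (ℕ; zero; suc; _+_; _<_; _≤_; s≤s)
open import Data.Nat.Properties using (≤-refl; m+n≡0⇒m≡0; m+n≡0⇒n≡0)
open import Data.Product using (Σ; _×_; _,_; proj₁; proj₂; ∃-syntax)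
open import Data.Product.Properties using (≡-dec)
open import Data.Product.Properties.WithK using (,-injectiveʳ)
open import Data.Sum using (_⊎_; inj₁; inj₂; map₂)
open import Function using (_∘_; flip; mk⇔)
open import Relation.Binary.PropositionalEquality using
  ( _≡_; _≢_; refl; sym; trans; cong; cong₂; subst; module ≡-Reasoning)
open import Relation.Binary.PropositionalEquality.WithK using (≡-irrelevant)
open import Relation.Nullary using (¬_; Dec; yes; no; does; contradiction; ¬?)
open import Relation.Nullary.Decidable using (dec-true; dec-false; does-⇔; _×-dec_)
import Data.Bool as Bool
import Data.Nat as ℕ
import Data.Nat.Properties as ℕ
import Data.Sum as Sum
open import Algebra.Properties.Semiring.Sum (CommutativeRing.semiring xor-∧-commutativeRing)
  using (sum; sum-cong-≗; ∑-distrib-+; ∑-comm; *-distribˡ-sum)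
open ≡-Reasoning

-- Parities

odd : ℕ → Bool
odd zero    = false
odd (suc m) = not (odd m)

odd-+ : ∀ m n → odd (m + n) ≡ odd m xor odd n
odd-+ zero    n = refl
odd-+ (suc m) n = trans (cong not (odd-+ m n)) (not-distribˡ-xor (odd m) (odd n))

Odd⇒odd : ∀ m → Odd m → odd m ≡ true
Odd⇒odd (suc zero)    _ = refl
Odd⇒odd (suc (suc m)) p = trans (not-involutive (odd m)) (Odd⇒odd m p)

odd⇒Odd : ∀ m → odd m ≡ true → Odd m
odd⇒Odd (suc zero)    _ = refl
odd⇒Odd (suc (suc m)) p = odd⇒Odd m (trans (sym (not-involutive (odd m))) p)

Even⇒¬odd : ∀ m → Even m → odd m ≡ false
Even⇒¬odd zero          _ = refl
Even⇒¬odd (suc (suc m)) p = trans (not-involutive (odd m)) (Even⇒¬odd m p)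

¬odd⇒Even : ∀ m → odd m ≡ false → Even m
¬odd⇒Even zero          _ = refl
¬odd⇒Even (suc (suc m)) p = ¬odd⇒Even m (trans (sym (not-involutive (odd m))) p)

odd-if : ∀ b → odd (if b then 1 else 0) ≡ b
odd-if false = refl
odd-if true  = refl

-- `sum` is taken in the ring of booleans under `xor` and `∧`, so counting modulo 2 becomes linear
-- algebra over the field with two elements.
odd-sumFin : ∀ {n} (f : Fin n → ℕ) → odd (sumFin f) ≡ sum (odd ∘ f)
odd-sumFin {zero}  f = refl
odd-sumFin {suc n} f = trans (odd-+ (f zero) _) (cong (odd (f zero) xor_) (odd-sumFin (f ∘ suc)))

sum-const : ∀ m b → sum {m} (λ _ → b) ≡ odd m ∧ b
sum-const zero    b     = refl
sum-const (suc m) false = trans (sum-const m false) (trans (∧-zeroʳ (odd m)) (sym (∧-zeroʳ (not (odd m)))))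
sum-const (suc m) true  =
  trans (cong not (trans (sum-const m true) (∧-identityʳ (odd m)))) (sym (∧-identityʳ (not (odd m))))

sum-false : ∀ {n} {f : Fin n → Bool} → (∀ i → f i ≡ false) → sum f ≡ false
sum-false {zero}  _ = refl
sum-false {suc n} z = cong₂ _xor_ (z zero) (sum-false (z ∘ suc))

sum-single : ∀ {n} (f : Fin n → Bool) i → (∀ j → j ≢ i → f j ≡ false) → sum f ≡ f i
sum-single f zero    z =
  trans (cong (f zero xor_) (sum-false λ j → z (suc j) λ ())) (xor-identityʳ (f zero))
sum-single f (suc i) z =
  cong₂ _xor_ (z zero λ ()) (sum-single (f ∘ suc) i λ j j≢i → z (suc j) (j≢i ∘ suc-injective))

sum-true : ∀ {n} (f : Fin n → Bool) → sum f ≡ true → ∃[ i ] f i ≡ true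
sum-true {suc n} f p with f zero in eq
... | true  = zero , eq
... | false with sum-true (f ∘ suc) p
...   | i , q = suc i , q

xor-shift : ∀ x e {r} → x xor e ≡ r → x ≡ r xor e
xor-shift false false refl = refl
xor-shift false true  refl = refl
xor-shift true  false refl = refl
xor-shift true  true  refl = refl

xor-interchange : ∀ a b c d → (a xor b) xor (c xor d) ≡ (a xor c) xor (b xor d)
xor-interchange = solve 4 (λ a b c d → (a :+ b) :+ (c :+ d) := (a :+ c) :+ (b :+ d)) refl
  where open xor-∧-Solver

true≢false : true ≢ false
true≢false ()

-- The Fredholm alternative over the field with two elements

module Alternative
  {W U : Set} (_⊞_ : W → W → W) (_⊕_ : U → U → U) (⟨_,_⟩ : U → W → Bool)
  (⟨⟩-⊞ : ∀ φ d e → ⟨ φ , d ⊞ e ⟩ ≡ ⟨ φ , d ⟩ xor ⟨ φ , e ⟩)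
  (⟨⟩-⊕ : ∀ φ ψ d → ⟨ φ ⊕ ψ , d ⟩ ≡ ⟨ φ , d ⟩ xor ⟨ ψ , d ⟩)
  (P : W → Set)
  (base : ∀ d → P d ⊎ ∃[ φ ] ⟨ φ , d ⟩ ≡ true)
  where

  Separates : U → List W → W → Set
  Separates φ gs d = All (λ g → ⟨ φ , g ⟩ ≡ false) gs × ⟨ φ , d ⟩ ≡ true

  -- Induction on the generators. As the vectors will be functions, membership in the span is
  -- replaced by a predicate `P` that can be pulled back along adding a generator. If `φ` separates
  -- `d` and `ψ` separates `d ⊞ g`, then one of `φ`, `ψ`, `φ ⊕ ψ` vanishes on `g` and is 1 on `d`.
  alternative : ∀ gs → (∀ {g} → g ∈ gs → ∀ d → P (d ⊞ g) → P d) →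
                ∀ d → P d ⊎ ∃[ φ ] Separates φ gs d
  alternative []       _    d with base d
  ... | inj₁ p       = inj₁ p
  ... | inj₂ (φ , q) = inj₂ (φ , [] , q)
  alternative (g ∷ gs) step d with alternative gs (step ∘ there) d | alternative gs (step ∘ there) (d ⊞ g)
  ... | inj₁ p | _ = inj₁ p
  ... | inj₂ _ | inj₁ p = inj₁ (step (here refl) d p)
  ... | inj₂ (φ , φ⊥ , φd) | inj₂ (ψ , ψ⊥ , ψdg)
    with ⟨ φ , g ⟩ in φg | ⟨ ψ , g ⟩ in ψg
  ...   | false | _     = inj₂ (φ , φg ∷ φ⊥ , φd)
  ...   | true  | false = inj₂ (ψ , ψg ∷ ψ⊥ ,
            trans (xor-shift ⟨ ψ , d ⟩ ⟨ ψ , g ⟩ (trans (sym (⟨⟩-⊞ ψ d g)) ψdg)) (cong not ψg))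
  ...   | true  | true  = inj₂ (φ ⊕ ψ ,
            trans (⟨⟩-⊕ φ ψ g) (cong₂ _xor_ φg ψg)
              ∷ All.zipWith (λ {h} (p , q) → trans (⟨⟩-⊕ φ ψ h) (cong₂ _xor_ p q)) (φ⊥ , ψ⊥) ,
            trans (⟨⟩-⊕ φ ψ d) (cong₂ _xor_ φd
              (trans (xor-shift ⟨ ψ , d ⟩ ⟨ ψ , g ⟩ (trans (sym (⟨⟩-⊞ ψ d g)) ψdg)) (cong not ψg))))

-- Sums over the vertices of a blow-up

module Blowup {n} (s : Fin n → ℕ) where

  V : Set
  V = EV s

  _≟V_ : (u v : V) → Dec (u ≡ v)
  _≟V_ = ≡-dec _≟_ _≟_

  is : V → V → Bool
  is u v = does (u ≟V v)

  ⨁ : (V → Bool) → Bool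
  ⨁ f = sum λ i → sum λ b → f (i , b)

  odd-sumEV : (f : V → ℕ) → odd (sumEV s f) ≡ ⨁ (odd ∘ f)
  odd-sumEV f = trans (odd-sumFin (λ i → sumFin λ b → f (i , b)))
    (sum-cong-≗ λ i → odd-sumFin λ b → f (i , b))

  ⨁-cong : ∀ {f g} → (∀ v → f v ≡ g v) → ⨁ f ≡ ⨁ g
  ⨁-cong f≗g = sum-cong-≗ λ i → sum-cong-≗ λ b → f≗g (i , b)

  ⨁-xor : ∀ f g → ⨁ (λ v → f v xor g v) ≡ ⨁ f xor ⨁ g
  ⨁-xor f g = trans (sum-cong-≗ λ i → ∑-distrib-+ (λ b → f (i , b)) _) (∑-distrib-+ {n} _ _)

  ∧-⨁ : ∀ b f → b ∧ ⨁ f ≡ ⨁ (λ v → b ∧ f v)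
  ∧-⨁ b f = trans (*-distribˡ-sum {n} b _) (sum-cong-≗ λ i → *-distribˡ-sum b λ c → f (i , c))

  ⨁-comm : (f : V → V → Bool) → ⨁ (λ u → ⨁ (f u)) ≡ ⨁ (λ v → ⨁ (λ u → f u v))
  ⨁-comm f = begin
    sum (λ i → sum λ b → sum λ j → sum λ c → f (i , b) (j , c))
      ≡⟨ sum-cong-≗ (λ i → ∑-comm (λ b j → sum λ c → f (i , b) (j , c))) ⟩
    sum (λ i → sum λ j → sum λ b → sum λ c → f (i , b) (j , c))
      ≡⟨ ∑-comm (λ i j → sum λ b → sum λ c → f (i , b) (j , c)) ⟩
    sum (λ j → sum λ i → sum λ b → sum λ c → f (i , b) (j , c))
      ≡⟨ sum-cong-≗ (λ j → sum-cong-≗ λ i → ∑-comm (λ b c → f (i , b) (j , c))) ⟩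
    sum (λ j → sum λ i → sum λ c → sum λ b → f (i , b) (j , c))
      ≡⟨ sum-cong-≗ (λ j → ∑-comm (λ i c → sum λ b → f (i , b) (j , c))) ⟩
    sum (λ j → sum λ c → sum λ i → sum λ b → f (i , b) (j , c)) ∎

  ⨁-class : (a : Fin n → Bool) → ⨁ (a ∘ proj₁) ≡ sum (λ i → odd (s i) ∧ a i)
  ⨁-class a = sum-cong-≗ λ i → sum-const (s i) (a i)

  ⨁-single : ∀ (f : V → Bool) v → (∀ w → w ≢ v → f w ≡ false) → ⨁ f ≡ f v
  ⨁-single f (i , b) z = trans
    (sum-single _ i λ j j≢i → sum-false λ c → z (j , c) (j≢i ∘ cong proj₁))
    (sum-single _ b λ c c≢b → z (i , c) λ { refl → c≢b refl })

  ⨁-false : ∀ {f : V → Bool} → (∀ v → f v ≡ false) → ⨁ f ≡ false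
  ⨁-false z = sum-false λ i → sum-false λ b → z (i , b)

  at : V → (V → Bool) → V → Bool
  at v h w = is v w ∧ h w

  ⨁-is : ∀ (A : V → Bool) v → ⨁ (λ w → A w ∧ is v w) ≡ A v
  ⨁-is A v = begin
    ⨁ (λ w → A w ∧ is v w)
      ≡⟨ ⨁-single (λ w → A w ∧ is v w) v (λ w w≢v →
           trans (cong (A w ∧_) (dec-false (v ≟V w) (w≢v ∘ sym))) (∧-zeroʳ (A w))) ⟩
    A v ∧ is v v           ≡⟨ cong (A v ∧_) (dec-true (v ≟V v) refl) ⟩
    A v ∧ true             ≡⟨ ∧-identityʳ (A v) ⟩
    A v                    ∎

  ⨁-at : ∀ (A : V → Bool) v h → ⨁ (λ w → A w ∧ at v h w) ≡ A v ∧ h v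
  ⨁-at A v h = trans (⨁-cong λ w → reorder (A w) (is v w) (h w)) (⨁-is (λ w → A w ∧ h w) v)
    where
    reorder : ∀ a i h → a ∧ (i ∧ h) ≡ (a ∧ h) ∧ i
    reorder = solve 3 (λ a i h → a :* (i :* h) := (a :* h) :* i) refl where open xor-∧-Solver

  vertices : List V
  vertices = concat (tabulate λ i → tabulate λ b → (i , b))

  ∈-vertices : ∀ v → v ∈ vertices
  ∈-vertices (i , b) = ∈-concat⁺′ (∈-tabulate⁺ b) (∈-tabulate⁺ i)

  -- A set F of arcs of R with prescribed parities α and β of the out- and in-degrees is sought.
  -- At each vertex v the prescription may be shifted by (δ⁺ v , δ⁻ v); it is void where ι⁺ (for α)
  -- or ι⁻ (for β) holds.
  module Duality (R : V → V → Bool) (δ⁺ δ⁻ ι⁺ ι⁻ : V → Bool) where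

    record Solution (α β : V → Bool) : Set where
      field
        F   : V → V → Bool
        t   : V → Bool
        out : ∀ v → ι⁺ v ≡ false → α v ≡ ⨁ (λ w → R v w ∧ F v w) xor (t v ∧ δ⁺ v)
        inn : ∀ v → ι⁻ v ≡ false → β v ≡ ⨁ (λ u → R u v ∧ F u v) xor (t v ∧ δ⁻ v)

    -- Each field but the last says that the functional `(A , B)` vanishes on one kind of generator
    -- (arcs, shifts, void equations); `total` says that it is 1 on the all-ones right-hand side.
    record Certificate : Set where
      field
        A B   : V → Bool
        arc   : ∀ u v → R u v ≡ true → A u ≡ B v
        shift : ∀ v → A v ∧ δ⁺ v ≡ B v ∧ δ⁻ v
        voidA : ∀ v → ι⁺ v ≡ true → A v ≡ false
        voidB : ∀ v → ι⁻ v ≡ true → B v ≡ false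
        total : ⨁ A xor ⨁ B ≡ true

    -- The linear system and its generators.

    private
      Vec : Set
      Vec = (V → Bool) × (V → Bool)

      _⊞_ : Vec → Vec → Vec
      (α , β) ⊞ (α′ , β′) = (λ v → α v xor α′ v) , (λ v → β v xor β′ v)

      dot : (V → Bool) → (V → Bool) → Bool
      dot A α = ⨁ λ v → A v ∧ α v

      ⟨_,_⟩ : Vec → Vec → Bool
      ⟨ (A , B) , (α , β) ⟩ = dot A α xor dot B β

      dotʳ : ∀ A α α′ → dot A (λ v → α v xor α′ v) ≡ dot A α xor dot A α′
      dotʳ A α α′ = trans (⨁-cong λ v → ∧-distribˡ-xor (A v) (α v) (α′ v)) (⨁-xor _ _)

      dotˡ : ∀ A A′ α → dot (λ v → A v xor A′ v) α ≡ dot A α xor dot A′ α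
      dotˡ A A′ α = trans (⨁-cong λ v → ∧-distribʳ-xor (α v) (A v) (A′ v)) (⨁-xor _ _)

      ⟨⟩-⊞ : ∀ φ d e → ⟨ φ , d ⊞ e ⟩ ≡ ⟨ φ , d ⟩ xor ⟨ φ , e ⟩
      ⟨⟩-⊞ (A , B) (α , β) (α′ , β′) =
        trans (cong₂ _xor_ (dotʳ A α α′) (dotʳ B β β′)) (xor-interchange (dot A α) _ _ _)

      ⟨⟩-⊕ : ∀ φ ψ d → ⟨ φ ⊞ ψ , d ⟩ ≡ ⟨ φ , d ⟩ xor ⟨ ψ , d ⟩
      ⟨⟩-⊕ (A , B) (A′ , B′) (α , β) =
        trans (cong₂ _xor_ (dotˡ A A′ α) (dotˡ B B′ β)) (xor-interchange (dot A α) _ _ _)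

      Solvable : Vec → Set
      Solvable (α , β) = Solution α β

      find : (α : V → Bool) → (∃[ v ] α v ≡ true) ⊎ (∀ v → α v ≡ false)
      find α with any? (λ i → any? (λ b → α (i , b) Bool.≟ true))
      ... | yes (i , b , p) = inj₁ ((i , b) , p)
      ... | no  ¬p          = inj₂ λ (i , b) → ¬-not λ p → ¬p (i , b , p)

      dot-is : ∀ v α → dot (is v) α ≡ α v
      dot-is v α = trans (⨁-cong λ w → ∧-comm (is v w) (α w)) (⨁-is α v)

      -- The zero right-hand side is solved by `F` and `t` zero; a nonzero entry is detected by the
      -- indicator of its vertex.
      base : ∀ d → Solvable d ⊎ ∃[ φ ] ⟨ φ , d ⟩ ≡ true
      base (α , β) with find α | find β
      ... | inj₁ (v , p) | _ = inj₂ ((is v , λ _ → false) ,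
            cong₂ _xor_ (trans (dot-is v α) p) (⨁-false {f = λ _ → false} λ _ → refl))
      ... | inj₂ _ | inj₁ (v , p) = inj₂ (((λ _ → false) , is v) ,
            cong₂ _xor_ (⨁-false {f = λ _ → false} λ _ → refl) (trans (dot-is v β) p))
      ... | inj₂ p | inj₂ q = inj₁ record
        { F   = λ _ _ → false
        ; t   = λ _ → false
        ; out = λ v _ → trans (p v) (sym (cong (_xor false) (⨁-false λ w → ∧-zeroʳ (R v w))))
        ; inn = λ v _ → trans (q v) (sym (cong (_xor false) (⨁-false λ u → ∧-zeroʳ (R u v))))
        }

      arcVec : V × V → Vec
      arcVec (u , v) = at u (λ w → R w v) , at v (λ w → R u w)

      shiftVec voidVec⁺ voidVec⁻ : V → Vec
      shiftVec v = at v δ⁺ , at v δ⁻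
      voidVec⁺ v = at v ι⁺ , λ _ → false
      voidVec⁻ v = (λ _ → false) , at v ι⁻

      arc-step : ∀ p d → Solvable (d ⊞ arcVec p) → Solvable d
      arc-step (u , v) (α , β) S = record
        { F   = λ w z → F w z xor (is u w ∧ is v z)
        ; t   = t
        ; out = λ w w∉ι → trans (xor-shift (α w) (at u (λ w → R w v) w) (out w w∉ι))
            (trans (swap (row w) _ _) (cong (_xor (t w ∧ δ⁺ w)) (sym (row′ w))))
        ; inn = λ z z∉ι → trans (xor-shift (β z) (at v (λ w → R u w) z) (inn z z∉ι))
            (trans (swap (col z) _ _) (cong (_xor (t z ∧ δ⁻ z)) (sym (col′ z))))
        }
        where
        open Solution S
        swap : ∀ a b c → (a xor b) xor c ≡ (a xor c) xor b
        swap = solve 3 (λ a b c → (a :+ b) :+ c := (a :+ c) :+ b) refl where open xor-∧-Solver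
        expand : ∀ r f a b → r ∧ (f xor (a ∧ b)) ≡ (r ∧ f) xor ((a ∧ r) ∧ b)
        expand = solve 4 (λ r f a b → r :* (f :+ a :* b) := r :* f :+ (a :* r) :* b) refl
          where open xor-∧-Solver
        expand′ : ∀ r f a b → r ∧ (f xor (a ∧ b)) ≡ (r ∧ f) xor ((b ∧ r) ∧ a)
        expand′ = solve 4 (λ r f a b → r :* (f :+ a :* b) := r :* f :+ (b :* r) :* a) refl
          where open xor-∧-Solver
        row col : V → Bool
        row w = ⨁ λ z → R w z ∧ F w z
        col z = ⨁ λ w → R w z ∧ F w z
        row′ : ∀ w → ⨁ (λ z → R w z ∧ (F w z xor (is u w ∧ is v z))) ≡ row w xor (is u w ∧ R w v)
        row′ w = trans
          (⨁-cong λ z → expand (R w z) (F w z) (is u w) (is v z))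
          (trans (⨁-xor _ _) (cong (row w xor_) (⨁-is (λ z → is u w ∧ R w z) v)))
        col′ : ∀ z → ⨁ (λ w → R w z ∧ (F w z xor (is u w ∧ is v z))) ≡ col z xor (is v z ∧ R u z)
        col′ z = trans
          (⨁-cong λ w → expand′ (R w z) (F w z) (is u w) (is v z))
          (trans (⨁-xor _ _) (cong (col z xor_) (⨁-is (λ w → is v z ∧ R w z) u)))

      shift-step : ∀ v d → Solvable (d ⊞ shiftVec v) → Solvable d
      shift-step v (α , β) S = record
        { F   = F
        ; t   = λ w → t w xor is v w
        ; out = λ w w∉ι → trans (xor-shift (α w) _ (out w w∉ι))
            (collect (⨁ λ z → R w z ∧ F w z) (t w) (is v w) (δ⁺ w))
        ; inn = λ w w∉ι → trans (xor-shift (β w) _ (inn w w∉ι))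
            (collect (⨁ λ z → R z w ∧ F z w) (t w) (is v w) (δ⁻ w))
        }
        where
        open Solution S
        collect : ∀ r t e d → (r xor (t ∧ d)) xor (e ∧ d) ≡ r xor ((t xor e) ∧ d)
        collect = solve 4 (λ r t e d → (r :+ t :* d) :+ e :* d := r :+ (t :+ e) :* d) refl
          where open xor-∧-Solver

      void-id : ∀ v (ι γ : V → Bool) {w} → ι w ≡ false → γ w ≡ γ w xor at v ι w
      void-id v ι γ {w} w∉ι = sym (trans
        (cong (λ b → γ w xor (is v w ∧ b)) w∉ι)
        (trans (cong (γ w xor_) (∧-zeroʳ (is v w))) (xor-identityʳ (γ w))))

      -- The added vector is supported where the out-equation is void, so the same `F` and `t` still
      -- solve the system.
      void⁺-step : ∀ v d → Solvable (d ⊞ voidVec⁺ v) → Solvable d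
      void⁺-step v (α , β) S = record
        { F = F ; t = t
        ; out = λ w w∉ι → trans (void-id v ι⁺ α w∉ι) (out w w∉ι)
        ; inn = λ w w∉ι → trans (sym (xor-identityʳ (β w))) (inn w w∉ι)
        }
        where open Solution S

      void⁻-step : ∀ v d → Solvable (d ⊞ voidVec⁻ v) → Solvable d
      void⁻-step v (α , β) S = record
        { F = F ; t = t
        ; out = λ w w∉ι → trans (sym (xor-identityʳ (α w))) (out w w∉ι)
        ; inn = λ w w∉ι → trans (void-id v ι⁻ β w∉ι) (inn w w∉ι)
        }
        where open Solution S

      -- Names for the generators: vectors are functions, so completeness of the list `gens` is
      -- proved for names.
      data Gen : Set where
        arcG        : V × V → Gen
        shiftG v⁺ v⁻ : V → Gen

      gen : Gen → Vec
      gen (arcG p)   = arcVec p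
      gen (shiftG v) = shiftVec v
      gen (v⁺ v)     = voidVec⁺ v
      gen (v⁻ v)     = voidVec⁻ v

      gen-step : ∀ g d → Solvable (d ⊞ gen g) → Solvable d
      gen-step (arcG p)   = arc-step p
      gen-step (shiftG v) = shift-step v
      gen-step (v⁺ v)     = void⁺-step v
      gen-step (v⁻ v)     = void⁻-step v

      gens : List Gen
      gens = map arcG (cartesianProduct vertices vertices)
        ++ map shiftG vertices ++ map v⁺ vertices ++ map v⁻ vertices

      ∈-gens : ∀ g → g ∈ gens
      ∈-gens (arcG (u , v)) =
        ∈-++⁺ˡ (∈-map⁺ arcG (∈-cartesianProduct⁺ (∈-vertices u) (∈-vertices v)))
      ∈-gens (shiftG v) = ∈-++⁺ʳ (map arcG (cartesianProduct vertices vertices))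
        (∈-++⁺ˡ (∈-map⁺ shiftG (∈-vertices v)))
      ∈-gens (v⁺ v) = ∈-++⁺ʳ (map arcG (cartesianProduct vertices vertices))
        (∈-++⁺ʳ (map shiftG vertices) (∈-++⁺ˡ (∈-map⁺ v⁺ (∈-vertices v))))
      ∈-gens (v⁻ v) = ∈-++⁺ʳ (map arcG (cartesianProduct vertices vertices))
        (∈-++⁺ʳ (map shiftG vertices) (∈-++⁺ʳ (map v⁺ vertices) (∈-map⁺ v⁻ (∈-vertices v))))

      gens-step : ∀ {w} → w ∈ map gen gens → ∀ d → Solvable (d ⊞ w) → Solvable d
      gens-step w∈ with ∈-map⁻ gen w∈
      ... | g , _ , refl = gen-step g

      certificate : ∀ A B → (∀ g → ⟨ (A , B) , gen g ⟩ ≡ false) ×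
                    ⟨ (A , B) , ((λ _ → true) , (λ _ → true)) ⟩ ≡ true → Certificate
      certificate A B (⊥gens , tot) = record
        { A = A ; B = B
        ; arc   = λ u v uRv → xor-false {A u} {B v} (trans
            (cong₂ _xor_ (on (A u) uRv) (on (B v) uRv))
            (trans (sym (cong₂ _xor_ (⨁-at A u (λ w → R w v)) (⨁-at B v (λ w → R u w)))) (⊥gens (arcG (u , v)))))
        ; shift = λ v → xor-false {A v ∧ δ⁺ v} {B v ∧ δ⁻ v}
            (trans (sym (cong₂ _xor_ (⨁-at A v δ⁺) (⨁-at B v δ⁻))) (⊥gens (shiftG v)))
        ; voidA = λ v v∈ι → trans (on (A v) v∈ι) (trans (sym (⨁-at A v ι⁺)) (trans
            (sym (xor-identityʳ (dot A (at v ι⁺)))) (trans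
              (cong (dot A (at v ι⁺) xor_) (sym (⨁-false λ w → ∧-zeroʳ (B w)))) (⊥gens (v⁺ v)))))
        ; voidB = λ v v∈ι → trans (on (B v) v∈ι) (trans (sym (⨁-at B v ι⁻)) (trans
              (cong (_xor dot B (at v ι⁻)) (sym (⨁-false λ w → ∧-zeroʳ (A w)))) (⊥gens (v⁻ v))))
        ; total = trans (cong₂ _xor_ (⨁-cong λ v → sym (∧-identityʳ (A v)))
                                     (⨁-cong λ v → sym (∧-identityʳ (B v)))) tot
        }
        where
        on : ∀ b {c} → c ≡ true → b ≡ b ∧ c
        on b refl = sym (∧-identityʳ b)
        xor-false : ∀ {a b} → a xor b ≡ false → a ≡ b
        xor-false {a} {b} p = xor-shift a b p

    strong-duality : Solution (λ _ → true) (λ _ → true) ⊎ Certificate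
    strong-duality with Alternative.alternative _⊞_ _⊞_ ⟨_,_⟩ ⟨⟩-⊞ ⟨⟩-⊕ Solvable base
      (map gen gens) (λ {g} → gens-step {g}) ((λ _ → true) , (λ _ → true))
    ... | inj₁ S = inj₁ S
    ... | inj₂ ((A , B) , ⊥gens , tot) =
      inj₂ (certificate A B ((λ g → All.lookup ⊥gens (∈-map⁺ gen (∈-gens g))) , tot))

    -- Weight the out-equation at `v` by `A v`, the in-equation by `B v`, and sum. `arc` equates the
    -- contributions of `F`, `shift` those of `t`, and the weights are zero at void equations; hence
    -- `⨁ A ≡ ⨁ B`, against `total`.
    weak-duality : Solution (λ _ → true) (λ _ → true) → ¬ Certificate
    weak-duality S C = true≢false (trans (sym total) (trans (cong (_xor ⨁ B) ⨁A≡⨁B) (xor-same (⨁ B))))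
      where
      open Solution S
      open Certificate C
      split : ∀ a t d {ι r} → (ι ≡ true → a ≡ false) → (ι ≡ false → true ≡ r xor (t ∧ d)) →
              a ≡ (a ∧ r) xor (t ∧ (a ∧ d))
      split false t _ _ _ = sym (∧-zeroʳ t)
      split true _ _ {ι = false} _ h = h refl
      split true _ _ {ι = true} z _ = contradiction (z refl) true≢false
      ⨁A≡⨁B : ⨁ A ≡ ⨁ B
      ⨁A≡⨁B = begin
        ⨁ A
          ≡⟨ ⨁-cong (λ v → split (A v) (t v) (δ⁺ v) (voidA v) (out v)) ⟩
        ⨁ (λ v → (A v ∧ ⨁ (λ w → R v w ∧ F v w)) xor (t v ∧ (A v ∧ δ⁺ v)))
          ≡⟨ ⨁-xor _ _ ⟩
        ⨁ (λ v → A v ∧ ⨁ (λ w → R v w ∧ F v w)) xor ⨁ (λ v → t v ∧ (A v ∧ δ⁺ v))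
          ≡⟨ cong₂ _xor_ arcs (⨁-cong λ v → cong (t v ∧_) (shift v)) ⟩
        ⨁ (λ v → B v ∧ ⨁ (λ u → R u v ∧ F u v)) xor ⨁ (λ v → t v ∧ (B v ∧ δ⁻ v))
          ≡⟨ ⨁-xor _ _ ⟨
        ⨁ (λ v → (B v ∧ ⨁ (λ u → R u v ∧ F u v)) xor (t v ∧ (B v ∧ δ⁻ v)))
          ≡⟨ ⨁-cong (λ v → split (B v) (t v) (δ⁻ v) (voidB v) (inn v)) ⟨
        ⨁ B ∎
        where
        along : ∀ u v → A u ∧ (R u v ∧ F u v) ≡ B v ∧ (R u v ∧ F u v)
        along u v with R u v in eq
        ... | true  = cong (_∧ F u v) (arc u v eq)
        ... | false = trans (∧-zeroʳ (A u)) (sym (∧-zeroʳ (B v)))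
        arcs : ⨁ (λ v → A v ∧ ⨁ (λ w → R v w ∧ F v w)) ≡ ⨁ (λ v → B v ∧ ⨁ (λ u → R u v ∧ F u v))
        arcs = begin
          ⨁ (λ u → A u ∧ ⨁ (λ v → R u v ∧ F u v))   ≡⟨ ⨁-cong (λ u → ∧-⨁ (A u) _) ⟩
          ⨁ (λ u → ⨁ (λ v → A u ∧ (R u v ∧ F u v))) ≡⟨ ⨁-cong (λ u → ⨁-cong (along u)) ⟩
          ⨁ (λ u → ⨁ (λ v → B v ∧ (R u v ∧ F u v))) ≡⟨ ⨁-comm _ ⟩
          ⨁ (λ v → ⨁ (λ u → B v ∧ (R u v ∧ F u v))) ≡⟨ ⨁-cong (λ v → ∧-⨁ (B v) _) ⟨
          ⨁ (λ v → B v ∧ ⨁ (λ u → R u v ∧ F u v))   ∎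

sumFin-cong : ∀ {n} {f g : Fin n → ℕ} → (∀ i → f i ≡ g i) → sumFin f ≡ sumFin g
sumFin-cong {zero}  _ = refl
sumFin-cong {suc n} p = cong₂ _+_ (p zero) (sumFin-cong (p ∘ suc))

sumEV-cong : ∀ {n} {s : Fin n → ℕ} {f g : EV s → ℕ} → (∀ v → f v ≡ g v) → sumEV s f ≡ sumEV s g
sumEV-cong p = sumFin-cong λ i → sumFin-cong λ b → p (i , b)

-- Weak-odd colorings of a blow-up

-- arcColInd splits on T i j together with a proof of T i j ≡ w (which is refl), so abstracting
-- T i j in a goal is ill-typed unless that refl is first replaced by value v for a variable
-- v : Value T i j (T i j), a type in which the left-hand T i j is out of reach of the abstraction.
record Value {n} (T : Fin n → Fin n → Bool) (i j : Fin n) (b : Bool) : Set where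
  constructor mk
  field value : T i j ≡ b
open Value

reflect : ∀ {n} {T : Fin n → Fin n → Bool} {i j b} (e : T i j ≡ b) → Σ (Value T i j b) λ v → value v ≡ e
reflect e = mk e , refl

arcColInd-view : ∀ {n k} (T : Fin n → Fin n → Bool) (s : Fin n → ℕ) (φ : EArc T s → Fin k) (x y : EV s) c →
  (Value T (proj₁ x) (proj₁ y) false × arcColInd T s φ x y c ≡ 0)
  ⊎ Σ (Value T (proj₁ x) (proj₁ y) true) λ e →
      arcColInd T s φ x y c ≡ (if does (φ (x , y , value e) ≟ c) then 1 else 0)
arcColInd-view T s φ x y c with refl {x = T (proj₁ x) (proj₁ y)}
... | e₁ with reflect {T = T} {proj₁ x} {proj₁ y} e₁
... | e₂ , refl with T (proj₁ x) (proj₁ y) | e₂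
... | false | e = inj₁ (e , refl)
... | true  | e with φ (x , y , value e) ≟ c in eq
...   | yes _ = inj₂ (e , sym (cong (if_then 1 else 0) (cong does eq)))
...   | no  _ = inj₂ (e , sym (cong (if_then 1 else 0) (cong does eq)))

does-true : ∀ {P : Set} (p? : Dec P) → does p? ≡ true → P
does-true (yes p) _ = p

does-false : ∀ {P : Set} (p? : Dec P) → does p? ≡ false → ¬ P
does-false (no ¬p) _ = ¬p

module Coloring {n} (T : Fin n → Fin n → Bool) (s : Fin n → ℕ) where

  open Blowup s

  arcs : V → V → Bool
  arcs u v = T (proj₁ u) (proj₁ v)

  odd-arcColInd : ∀ {k} (col : V → V → Fin k) u v c →
    odd (arcColInd T s (λ (x , y , _) → col x y) u v c) ≡ arcs u v ∧ does (col u v ≟ c)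
  odd-arcColInd col u v c with arcColInd-view T s (λ (x , y , _) → col x y) u v c
  ... | inj₁ (mk e , p) = trans (cong odd p) (cong (_∧ does (col u v ≟ c)) (sym e))
  ... | inj₂ (mk e , p) = trans (cong odd p)
    (trans (odd-if (does (col u v ≟ c))) (cong (_∧ does (col u v ≟ c)) (sym e)))

  arcs-∧-arcColInd : ∀ {k} (φ : EArc T s → Fin k) u v c →
    arcs u v ∧ odd (arcColInd T s φ u v c) ≡ odd (arcColInd T s φ u v c)
  arcs-∧-arcColInd φ u v c with arcColInd-view T s φ u v c
  ... | inj₁ (mk e , p) = trans (cong (_∧ odd (arcColInd T s φ u v c)) e) (cong odd (sym p))
  ... | inj₂ (mk e , p) = cong (_∧ odd (arcColInd T s φ u v c)) e

  -- With two colors, the second class is the complement of the first among the arcs. The two views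
  -- carry separate proofs of being an arc, which `≡-irrelevant` identifies.
  arcColInd-complement : ∀ (φ : EArc T s → Fin 2) u v →
    odd (arcColInd T s φ u v (suc zero)) ≡ odd (arcColInd T s φ u v zero) xor odd (arcInd T s u v)
  arcColInd-complement φ u v
    with arcColInd-view T s φ u v zero | arcColInd-view T s φ u v (suc zero)
  ... | inj₁ (mk e , p) | inj₁ (_ , q) = trans (cong odd q)
        (sym (cong₂ _xor_ (cong odd p) (trans (odd-if _) e)))
  ... | inj₁ (mk e , _) | inj₂ (mk f , _) = contradiction (trans (sym f) e) true≢false
  ... | inj₂ (mk e , _) | inj₁ (mk f , _) = contradiction (trans (sym e) f) true≢false
  ... | inj₂ (mk e , p) | inj₂ (mk f , q) = trans (cong odd q) (trans
        (trans (cong (λ h → odd (if does (φ (u , v , h) ≟ suc zero) then 1 else 0)) (≡-irrelevant f e))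
               (two-colors (φ (u , v , e))))
        (cong₂ _xor_ (cong odd (sym p)) (sym (trans (odd-if _) e))))
    where
    two-colors : ∀ (c : Fin 2) → odd (if does (c ≟ suc zero) then 1 else 0)
      ≡ odd (if does (c ≟ zero) then 1 else 0) xor true
    two-colors zero       = refl
    two-colors (suc zero) = refl

  arcColInd-inject : ∀ {k l} (φ : EArc T s → Fin k) (ι : Fin k → Fin l) → (∀ {c d} → ι c ≡ ι d → c ≡ d) →
    ∀ u v c → arcColInd T s (ι ∘ φ) u v (ι c) ≡ arcColInd T s φ u v c
  arcColInd-inject φ ι inj u v c with arcColInd-view T s φ u v c | arcColInd-view T s (ι ∘ φ) u v (ι c)
  ... | inj₁ (_ , p) | inj₁ (_ , q) = trans q (sym p)
  ... | inj₁ (mk e , _) | inj₂ (mk f , _) = contradiction (trans (sym f) e) true≢false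
  ... | inj₂ (mk e , _) | inj₁ (mk f , _) = contradiction (trans (sym e) f) true≢false
  ... | inj₂ (mk e , p) | inj₂ (mk f , q) = trans q (trans
        (cong (if_then 1 else 0) (trans
          (cong (λ h → does (ι (φ (u , v , h)) ≟ ι c)) (≡-irrelevant f e))
          (does-⇔ (mk⇔ inj (cong ι)) (ι (φ (u , v , e)) ≟ ι c) (φ (u , v , e) ≟ c))))
        (sym p))

  arcColInd-flip : ∀ {k} (φ : EArc (flip T) s → Fin k) u v c →
    arcColInd T s (λ (x , y , a) → φ (y , x , a)) u v c ≡ arcColInd (flip T) s φ v u c
  arcColInd-flip φ u v c
    with arcColInd-view T s (λ (x , y , a) → φ (y , x , a)) u v c | arcColInd-view (flip T) s φ v u c
  ... | inj₁ (_ , p) | inj₁ (_ , q) = trans p (sym q)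
  ... | inj₁ (mk e , _) | inj₂ (mk f , _) = contradiction (trans (sym f) e) true≢false
  ... | inj₂ (mk e , _) | inj₁ (mk f , _) = contradiction (trans (sym e) f) true≢false
  ... | inj₂ (mk e , p) | inj₂ (mk f , q) = trans p (trans
        (cong (λ h → if does (φ (v , u , h) ≟ c) then 1 else 0) (≡-irrelevant e f)) (sym q))

  -- Additional colors can be left empty, so excluding two colors also excludes fewer.
  coloring-mono : ∀ {k l} → k ≤ l → HasWeakOddColoring T s k → HasWeakOddColoring T s l
  coloring-mono k≤l (φ , wo) = (λ a → inject≤ (φ a) k≤l) , λ v → map₂ (lift v) (wo v)
    where
    same = arcColInd-inject φ (λ c → inject≤ c k≤l) (inject≤-injective k≤l k≤l _ _)
    lift : ∀ v → _ → _
    lift v (c , p , q) = inject≤ c k≤l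
      , (λ h → subst Odd (sumEV-cong {s = s} λ w → sym (same v w c)) (p h))
      , (λ h → subst Odd (sumEV-cong {s = s} λ u → sym (same u v c)) (q h))

  -- Condition (WO) is symmetric in the two semi-cuts, so it survives the reversal of all arcs.
  coloring-flip : ∀ {k} → HasWeakOddColoring (flip T) s k → HasWeakOddColoring T s k
  coloring-flip (φ , wo) = (λ (x , y , a) → φ (y , x , a)) , λ v → Sum.map
    (λ (p , q) → q , p)
    (λ (c , p , q) → c
      , (λ h → subst Odd (sumEV-cong {s = s} λ w → sym (arcColInd-flip φ v w c)) (q h))
      , (λ h → subst Odd (sumEV-cong {s = s} λ u → sym (arcColInd-flip φ u v c)) (p h)))
    (wo v)

  δ⁺ δ⁻ ι⁺ ι⁻ : V → Bool
  δ⁺ v = odd (outDeg T s v)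
  δ⁻ v = odd (inDeg T s v)
  ι⁺ v = does (outDeg T s v ℕ.≟ 0)
  ι⁻ v = does (inDeg T s v ℕ.≟ 0)

  -- The first color is used on F, and t v records that v is satisfied by the second one.
  open Duality arcs δ⁺ δ⁻ ι⁺ ι⁻ public

  odd-outCol : ∀ {k} (φ : EArc T s → Fin k) v c →
    odd (outCol T s φ v c) ≡ ⨁ (λ w → odd (arcColInd T s φ v w c))
  odd-outCol φ v c = odd-sumEV λ w → arcColInd T s φ v w c

  odd-inCol : ∀ {k} (φ : EArc T s → Fin k) v c →
    odd (inCol T s φ v c) ≡ ⨁ (λ u → odd (arcColInd T s φ u v c))
  odd-inCol φ v c = odd-sumEV λ u → arcColInd T s φ u v c

  outCol-complement : ∀ (φ : EArc T s → Fin 2) v →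
    odd (outCol T s φ v (suc zero)) ≡ odd (outCol T s φ v zero) xor δ⁺ v
  outCol-complement φ v = trans (odd-outCol φ v _) (trans
    (⨁-cong λ w → arcColInd-complement φ v w)
    (trans (⨁-xor _ _) (sym (cong₂ _xor_ (odd-outCol φ v _) (odd-sumEV λ w → arcInd T s v w)))))

  inCol-complement : ∀ (φ : EArc T s → Fin 2) v →
    odd (inCol T s φ v (suc zero)) ≡ odd (inCol T s φ v zero) xor δ⁻ v
  inCol-complement φ v = trans (odd-inCol φ v _) (trans
    (⨁-cong λ u → arcColInd-complement φ u v)
    (trans (⨁-xor _ _) (sym (cong₂ _xor_ (odd-inCol φ v _) (odd-sumEV λ u → arcInd T s u v)))))

  private
    𝟙 : V → Bool
    𝟙 _ = true

  -- Where the second color satisfies `v`, its counts are those of the first color plus the degrees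
  -- modulo 2; this is the shift by `(δ⁺ v , δ⁻ v)`.
  coloring⇒solution : HasWeakOddColoring T s 2 → Solution 𝟙 𝟙
  coloring⇒solution (φ , wo) = record
    { F   = λ u v → odd (arcColInd T s φ u v zero)
    ; t   = λ v → second (wo v)
    ; out = λ v v∉ι → trans (out v (wo v) (does-false (outDeg T s v ℕ.≟ 0) v∉ι)) (cong (_xor (second (wo v) ∧ δ⁺ v))
        (trans (odd-outCol φ v zero) (⨁-cong λ w → sym (arcs-∧-arcColInd φ v w zero))))
    ; inn = λ v v∉ι → trans (inn v (wo v) (does-false (inDeg T s v ℕ.≟ 0) v∉ι)) (cong (_xor (second (wo v) ∧ δ⁻ v))
        (trans (odd-inCol φ v zero) (⨁-cong λ u → sym (arcs-∧-arcColInd φ u v zero))))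
    }
    where
    second : ∀ {v} → WO T s φ v → Bool
    -- Both equations are void at such a vertex, so either value would do.
    second (inj₁ _)           = false
    second (inj₂ (zero  , _)) = false
    second (inj₂ (suc _ , _)) = true
    out : ∀ v (p : WO T s φ v) → outDeg T s v ≢ 0 → true ≡ odd (outCol T s φ v zero) xor (second p ∧ δ⁺ v)
    out v (inj₁ (z , _)) h = contradiction z h
    out v (inj₂ (zero , p , _)) h =
      sym (trans (xor-identityʳ (odd (outCol T s φ v zero))) (Odd⇒odd (outCol T s φ v zero) (p h)))
    out v (inj₂ (suc zero , p , _)) h =
      sym (trans (sym (outCol-complement φ v)) (Odd⇒odd (outCol T s φ v (suc zero)) (p h)))
    inn : ∀ v (p : WO T s φ v) → inDeg T s v ≢ 0 → true ≡ odd (inCol T s φ v zero) xor (second p ∧ δ⁻ v)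
    inn v (inj₁ (_ , z)) h = contradiction z h
    inn v (inj₂ (zero , _ , p)) h =
      sym (trans (xor-identityʳ (odd (inCol T s φ v zero))) (Odd⇒odd (inCol T s φ v zero) (p h)))
    inn v (inj₂ (suc zero , _ , p)) h =
      sym (trans (sym (inCol-complement φ v)) (Odd⇒odd (inCol T s φ v (suc zero)) (p h)))

  solution⇒coloring : Solution 𝟙 𝟙 → HasWeakOddColoring T s 2
  -- A vertex with two empty semi-cuts also fits the second alternative of `WO`, both implications
  -- being vacuous there.
  solution⇒coloring S = φ , λ v → inj₂ (witness v)
    where
    open Solution S
    col : V → V → Fin 2
    col u v = if F u v then zero else suc zero
    φ : EArc T s → Fin 2
    φ (u , v , _) = col u v
    col-zero : ∀ u v → does (col u v ≟ zero) ≡ F u v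
    col-zero u v with F u v
    ... | true  = refl
    ... | false = refl
    F-arc : ∀ u v → odd (arcColInd T s φ u v zero) ≡ arcs u v ∧ F u v
    F-arc u v = trans (odd-arcColInd col u v zero) (cong (arcs u v ∧_) (col-zero u v))
    outF : ∀ v → outDeg T s v ≢ 0 → true ≡ odd (outCol T s φ v zero) xor (t v ∧ δ⁺ v)
    outF v h = trans (out v (dec-false (outDeg T s v ℕ.≟ 0) h))
      (cong (_xor (t v ∧ δ⁺ v)) (sym (trans (odd-outCol φ v zero) (⨁-cong (F-arc v)))))
    inF : ∀ v → inDeg T s v ≢ 0 → true ≡ odd (inCol T s φ v zero) xor (t v ∧ δ⁻ v)
    inF v h = trans (inn v (dec-false (inDeg T s v ℕ.≟ 0) h))
      (cong (_xor (t v ∧ δ⁻ v)) (sym (trans (odd-inCol φ v zero) (⨁-cong λ u → F-arc u v))))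
    witness : ∀ v → ∃[ c ] ((outDeg T s v ≢ 0 → Odd (outCol T s φ v c))
                          × (inDeg T s v ≢ 0 → Odd (inCol T s φ v c)))
    witness v with t v | outF v | inF v
    ... | false | p | q = zero
          , (λ h → odd⇒Odd (outCol T s φ v zero) (sym (trans (p h) (xor-identityʳ (odd (outCol T s φ v zero))))))
          , (λ h → odd⇒Odd (inCol T s φ v zero) (sym (trans (q h) (xor-identityʳ (odd (inCol T s φ v zero))))))
    ... | true  | p | q = suc zero
          , (λ h → odd⇒Odd (outCol T s φ v (suc zero)) (trans (outCol-complement φ v) (sym (p h))))
          , (λ h → odd⇒Odd (inCol T s φ v (suc zero)) (trans (inCol-complement φ v) (sym (q h))))

-- Certificates on the classes, and bad extended tournaments

sumFin≡0 : ∀ {n} (f : Fin n → ℕ) → sumFin f ≡ 0 → ∀ i → f i ≡ 0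
sumFin≡0 f p zero    = m+n≡0⇒m≡0 (f zero) p
sumFin≡0 f p (suc i) = sumFin≡0 (f ∘ suc) (m+n≡0⇒n≡0 (f zero) p) i

sumFin-zero : ∀ {n} {f : Fin n → ℕ} → (∀ i → f i ≡ 0) → sumFin f ≡ 0
sumFin-zero {zero}  _ = refl
sumFin-zero {suc n} z = cong₂ _+_ (z zero) (sumFin-zero (z ∘ suc))

sum-pair : ∀ {n} (f : Fin n → Bool) {x y} → x ≢ y → (∀ i → i ≢ x → i ≢ y → f i ≡ false) →
  sum f ≡ f x xor f y
sum-pair f {x} {y} x≢y z = begin
  sum f
    ≡⟨ sum-cong-≗ split ⟩
  sum (λ i → (does (i ≟ x) ∧ f i) xor (does (i ≟ y) ∧ f i))
    ≡⟨ ∑-distrib-+ (λ i → does (i ≟ x) ∧ f i) _ ⟩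
  sum (λ i → does (i ≟ x) ∧ f i) xor sum (λ i → does (i ≟ y) ∧ f i)
    ≡⟨ cong₂ _xor_ (at x) (at y) ⟩
  f x xor f y ∎
  where
  at : ∀ k → sum (λ i → does (i ≟ k) ∧ f i) ≡ f k
  at k = trans (sum-single (λ i → does (i ≟ k) ∧ f i) k λ j j≢k → cong (_∧ f j) (dec-false (j ≟ k) j≢k))
    (cong (_∧ f k) (dec-true (k ≟ k) refl))
  split : ∀ i → f i ≡ (does (i ≟ x) ∧ f i) xor (does (i ≟ y) ∧ f i)
  split i with i ≟ x | i ≟ y
  ... | yes refl | yes refl = contradiction refl x≢y
  ... | yes _    | no  _    = sym (xor-identityʳ (f i))
  ... | no  _    | yes _    = refl
  ... | no i≢x   | no i≢y   = z i i≢x i≢y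

count-unique : ∀ {n} (p : Fin n → Bool) x → p x ≡ true → (∀ i → i ≢ x → p i ≡ false) → countFin p ≡ 1
count-unique p zero    px z rewrite px =
  cong suc (sumFin-zero λ i → cong (if_then 1 else 0) (z (suc i) λ ()))
count-unique p (suc x) px z rewrite z zero (λ ()) =
  count-unique (p ∘ suc) x px λ i i≢x → z (suc i) (i≢x ∘ suc-injective)

if≡0 : ∀ {b} → (if b then 1 else 0) ≡ 0 → b ≡ false
if≡0 {false} _ = refl

unique-count : ∀ {n} (p : Fin n → Bool) → countFin p ≡ 1 →
  ∃[ x ] (p x ≡ true × (∀ i → i ≢ x → p i ≡ false))
unique-count {suc n} p c with p zero in eq
... | true  = zero , eq , λ
  { zero    0≢0 → contradiction refl 0≢0
  ; (suc i) _   → if≡0 (sumFin≡0 (λ i → if p (suc i) then 1 else 0) (ℕ.suc-injective c) i) }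
... | false with unique-count (p ∘ suc) c
...   | x , px , z = suc x , px , λ
  { zero    _   → eq
  ; (suc i) i≢x → z i (i≢x ∘ cong suc) }

-- `y′` is the position of `y` among the vertices other than `x`; two nested `punchIn` skip both,
-- and `3 < n` leaves at least two indices.
two-others : ∀ {n} → 3 < n → {x y : Fin n} → x ≢ y →
  ∃[ v ] ∃[ w ] (v ≢ w × (v ≢ x × v ≢ y) × (w ≢ x × w ≢ y))
two-others (s≤s (s≤s (s≤s (s≤s _)))) {x} {y} x≢y =
  other zero , other (suc zero) , distinct , avoids zero , avoids (suc zero)
  where
  y′ = punchOut x≢y
  other : Fin _ → Fin _
  other k = punchIn x (punchIn y′ k)
  distinct : other zero ≢ other (suc zero)
  distinct p with punchIn-injective y′ _ _ (punchIn-injective x _ _ p)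
  ... | ()
  avoids : ∀ k → other k ≢ x × other k ≢ y
  avoids k = punchInᵢ≢i x _ ,
    λ p → punchInᵢ≢i y′ k (punchIn-injective x _ _ (trans p (sym (punchIn-punchOut x≢y))))

module Tournament {n} {T : Fin n → Fin n → Bool} (tour : IsTournament T) where

  arc⇒≢ : ∀ {i j} → T i j ≡ true → i ≢ j
  arc⇒≢ {i} p refl = true≢false (trans (sym p) (proj₁ tour i))

  asym : ∀ {i j} → T i j ≡ true → T j i ≡ false
  asym {i} {j} p = trans (proj₂ tour j i (arc⇒≢ p ∘ sym)) (cong not p)

  connex : ∀ {i j} → i ≢ j → T i j ≡ false → T j i ≡ true
  connex {i} {j} i≢j p = trans (proj₂ tour j i (i≢j ∘ sym)) (cong not p)

tournament-flip : ∀ {n} {T : Fin n → Fin n → Bool} → IsTournament T → IsTournament (flip T)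
tournament-flip (irr , ant) = irr , λ i j i≢j → ant j i (i≢j ∘ sym)

Bad-flip : ∀ {n} (T : Fin n → Fin n → Bool) s → Bad (flip T) s → Bad T s
Bad-flip T s (n>3 , N , j , sj , si , dom , inj₁ c) =
  n>3 , N , j , sj , si , (λ u w p q → dom w u q p) , inj₂ c
Bad-flip T s (n>3 , N , j , sj , si , dom , inj₂ c) =
  n>3 , N , j , sj , si , (λ u w p q → dom w u q p) , inj₁ c

module Parity {n} (T : Fin n → Fin n → Bool) (s : Fin n → ℕ) where

  σ : Fin n → Bool
  σ i = odd (s i)

  -- Degree parities in the blow-up of any vertex of class `i`; even classes contribute nothing.
  D⁺ D⁻ : Fin n → Bool
  D⁺ i = sum λ j → σ j ∧ T i j
  D⁻ i = sum λ j → σ j ∧ T j i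

  -- Each other class is joined to class `i` in exactly one direction, and `σ i` accounts for the
  -- class itself, so all vertices are counted once.
  degree-sum : IsTournament T → ∀ i → (D⁺ i xor D⁻ i) xor σ i ≡ sum σ
  degree-sum (irr , ant) i = begin
    (D⁺ i xor D⁻ i) xor σ i
      ≡⟨ cong₂ _xor_ (∑-distrib-+ (λ j → σ j ∧ T i j) _) single ⟨
    sum (λ j → (σ j ∧ T i j) xor (σ j ∧ T j i)) xor sum (λ j → σ j ∧ does (i ≟ j))
      ≡⟨ ∑-distrib-+ (λ j → (σ j ∧ T i j) xor (σ j ∧ T j i)) _ ⟨
    sum (λ j → ((σ j ∧ T i j) xor (σ j ∧ T j i)) xor (σ j ∧ does (i ≟ j)))
      ≡⟨ sum-cong-≗ collect ⟩
    sum σ ∎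
    where
    single : sum (λ j → σ j ∧ does (i ≟ j)) ≡ σ i
    single = trans
      (sum-single (λ j → σ j ∧ does (i ≟ j)) i λ j j≢i →
        trans (cong (σ j ∧_) (dec-false (i ≟ j) (j≢i ∘ sym))) (∧-zeroʳ (σ j)))
      (trans (cong (σ i ∧_) (dec-true (i ≟ i) refl)) (∧-identityʳ (σ i)))
    table : ∀ b t → ((b ∧ not t) xor (b ∧ t)) xor (b ∧ false) ≡ b
    table false _     = refl
    table true  false = refl
    table true  true  = refl
    collect : ∀ j → ((σ j ∧ T i j) xor (σ j ∧ T j i)) xor (σ j ∧ does (i ≟ j)) ≡ σ j
    collect j with i ≟ j
    ... | no  i≢j rewrite ant i j i≢j = table (σ j) (T j i)
    ... | yes refl rewrite irr i | ∧-zeroʳ (σ i) = ∧-identityʳ (σ i)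

  -- A `Certificate` constant on classes: void equations become sinks and sources of `T`, and the
  -- sum over a class becomes a factor `σ i`.
  record ClassCertificate : Set where
    field
      a b    : Fin n → Bool
      arc    : ∀ i j → T i j ≡ true → a i ≡ b j
      shift  : ∀ i → a i ∧ D⁺ i ≡ b i ∧ D⁻ i
      sink   : ∀ i → (∀ j → T i j ≡ false) → a i ≡ false
      source : ∀ i → (∀ j → T j i ≡ false) → b i ≡ false
      total  : sum (λ i → σ i ∧ (a i xor b i)) ≡ true

  -- The bad case in which the even class `y` has the single out-neighbour `x`; the case of a single
  -- in-neighbour is its reversal.
  record Exceptional (x y : Fin n) : Set where
    field
      y⇒x  : T y x ≡ true
      x⇒   : ∀ w → w ≢ x → w ≢ y → T x w ≡ true
      ⇒y   : ∀ w → w ≢ x → w ≢ y → T w y ≡ true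
      even : σ y ≡ false
      odds : ∀ i → i ≢ y → σ i ≡ true
      size : sum σ ≡ true

module _ {n} {T : Fin n → Fin n → Bool} (tour : IsTournament T) (s : Fin n → ℕ) where

  open Tournament tour
  open Parity T s

  -- Every class other than `x` and `y` dominates `y`, and condition (c) then makes `x` dominate it.
  bad⇒exceptional : Odd (sumFin s) → ∀ y → Even (s y) → (∀ i → i ≢ y → Odd (s i)) →
    (∀ u w → T y u ≡ true → T w y ≡ true → T u w ≡ true) → outNb T y ≡ 1 → ∃[ x ] Exceptional x y
  bad⇒exceptional N y sy si dom c with unique-count (T y) c
  ... | x , y⇒x , z = x , record
    { y⇒x  = y⇒x
    ; x⇒   = λ w w≢x w≢y → dom x w y⇒x (⇒y w w≢x w≢y)
    ; ⇒y   = ⇒y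
    ; even = Even⇒¬odd (s y) sy
    ; odds = λ i i≢y → Odd⇒odd (s i) (si i i≢y)
    ; size = trans (sym (odd-sumFin s)) (Odd⇒odd (sumFin s) N)
    }
    where
    ⇒y : ∀ w → w ≢ x → w ≢ y → T w y ≡ true
    ⇒y w w≢x w≢y = connex (w≢y ∘ sym) (z w w≢x)

  out-only : ∀ {x y} → Exceptional x y → ∀ w → w ≢ x → T y w ≡ false
  out-only {x} {y} E w w≢x with w ≟ y
  ... | yes refl = proj₁ tour w
  ... | no  w≢y  = asym (Exceptional.⇒y E w w≢x w≢y)

  out-odd : ∀ {x y} → Exceptional x y → D⁺ y ≡ true
  out-odd {x} {y} E = trans
    (sum-single (λ j → σ j ∧ T y j) x λ j j≢x → trans (cong (σ j ∧_) (out-only E j j≢x)) (∧-zeroʳ (σ j)))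
    (cong₂ _∧_ (odds x (arc⇒≢ y⇒x ∘ sym)) y⇒x)
    where open Exceptional E

  exceptional⇒bad : 3 < n → ∀ {x y} → Exceptional x y → Bad T s
  exceptional⇒bad n>3 {x} {y} E =
    n>3 , odd⇒Odd (sumFin s) (trans (odd-sumFin s) size) , y , ¬odd⇒Even (s y) even ,
    (λ i i≢y → odd⇒Odd (s i) (odds i i≢y)) , dom ,
    inj₂ (count-unique (T y) x y⇒x (out-only E))
    where
    open Exceptional E
    dom : ∀ u w → T y u ≡ true → T w y ≡ true → T u w ≡ true
    dom u w p q with u ≟ x
    ... | no u≢x   = contradiction (trans (sym p) (out-only E u u≢x)) true≢false
    ... | yes refl = x⇒ w (λ { refl → true≢false (trans (sym q) (asym y⇒x)) }) (arc⇒≢ q)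

  -- (a , b) marks the components of the bipartite double cover other than the one formed by the
  -- arcs from y to x.
  exceptional⇒certificate : 3 < n → ∀ {x y} → Exceptional x y → ClassCertificate
  exceptional⇒certificate n>3 {x} {y} E = record
    { a = a ; b = b
    ; arc    = arc
    ; shift  = shift
    ; sink   = sink
    ; source = source
    ; total  = trans (sum-single (λ i → σ i ∧ (a i xor b i)) x off)
        (cong₂ _∧_ (odds x x≢y) (cong₂ _xor_ ax bx))
    }
    where
    open Exceptional E
    a b : Fin n → Bool
    a i = not (does (i ≟ y))
    b i = not (does (i ≟ x))
    x≢y : x ≢ y
    x≢y = arc⇒≢ y⇒x ∘ sym
    ay : a y ≡ false
    ay = cong not (dec-true (y ≟ y) refl)
    a≢ : ∀ {i} → i ≢ y → a i ≡ true
    a≢ {i} i≢y = cong not (dec-false (i ≟ y) i≢y)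
    bx : b x ≡ false
    bx = cong not (dec-true (x ≟ x) refl)
    b≢ : ∀ {i} → i ≢ x → b i ≡ true
    b≢ {i} i≢x = cong not (dec-false (i ≟ x) i≢x)
    ax : a x ≡ true
    ax = a≢ x≢y
    only-y : ∀ {i} → i ≢ y → T i x ≡ false
    only-y {i} i≢y with i ≟ x
    ... | yes refl = proj₁ tour i
    ... | no  i≢x  = asym (x⇒ i i≢x i≢y)
    arc : ∀ i j → T i j ≡ true → a i ≡ b j
    arc i j p with i ≟ y | j ≟ x
    ... | yes _    | yes _   = refl
    ... | no  _    | no  _   = refl
    ... | yes refl | no j≢x  = contradiction (trans (sym p) (out-only E j j≢x)) true≢false
    ... | no i≢y   | yes refl = contradiction (trans (sym p) (only-y i≢y)) true≢false
    D⁻x : D⁻ x ≡ false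
    D⁻x = trans (sum-single (λ j → σ j ∧ T j x) y λ j j≢y → trans (cong (σ j ∧_) (only-y j≢y)) (∧-zeroʳ (σ j)))
      (cong (_∧ T y x) even)
    solve⁺ : ∀ {p q r} → (p xor q) xor r ≡ true → r ≡ true → p ≡ q
    solve⁺ {false} {false} _ _ = refl
    solve⁺ {true} {true} _ _ = refl
    solve⁺ {false} {true} () refl
    solve⁺ {true} {false} () refl
    solve⁻ : ∀ {p q r} → (p xor q) xor r ≡ true → r ≡ false → p ≡ true → q ≡ false
    solve⁻ {q = false} _ _ _ = refl
    solve⁻ {q = true} () refl refl
    degrees : ∀ i → (D⁺ i xor D⁻ i) xor σ i ≡ true
    degrees i = trans (degree-sum tour i) size
    -- The order is odd, so odd classes have equal degree parities. At `x` both are 0, its only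
    -- in-neighbour `y` being even; at `y` the out-parity is 1, so the in-parity is 0.
    shift : ∀ i → a i ∧ D⁺ i ≡ b i ∧ D⁻ i
    shift i with i ≟ x | i ≟ y
    ... | yes refl | yes refl = contradiction refl x≢y
    ... | yes refl | no  _ = trans (solve⁺ (degrees i) (odds i x≢y)) D⁻x
    ... | no  _ | yes refl = sym (solve⁻ (degrees i) even (out-odd E))
    ... | no  _ | no  i≢y  = solve⁺ (degrees i) (odds i i≢y)
    some : ∃[ w ] (w ≢ x × w ≢ y)
    some with two-others n>3 x≢y
    ... | w , _ , _ , p , _ = w , p
    w = proj₁ some
    w≢x = proj₁ (proj₂ some)
    w≢y = proj₂ (proj₂ some)
    sink : ∀ i → (∀ j → T i j ≡ false) → a i ≡ false
    sink i none with i ≟ x | i ≟ y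
    ... | _        | yes _   = refl
    ... | yes refl | no  _   = contradiction (trans (sym (x⇒ w w≢x w≢y)) (none w)) true≢false
    ... | no  i≢x  | no  i≢y = contradiction (trans (sym (⇒y i i≢x i≢y)) (none y)) true≢false
    source : ∀ i → (∀ j → T j i ≡ false) → b i ≡ false
    source i none with i ≟ x | i ≟ y
    ... | yes _   | _        = refl
    ... | no  _   | yes refl = contradiction (trans (sym (⇒y w w≢x w≢y)) (none w)) true≢false
    ... | no  i≢x | no  i≢y  = contradiction (trans (sym (x⇒ i i≢x i≢y)) (none x)) true≢false
    off : ∀ i → i ≢ x → σ i ∧ (a i xor b i) ≡ false
    off i i≢x with i ≟ y
    ... | yes refl = cong (_∧ _) even
    ... | no  _    = trans (cong (λ c → σ i ∧ not c) (b≢ i≢x)) (∧-zeroʳ (σ i))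

  -- Call `(a i , b i)` the type of `i`. By `arc`, no arc in either direction could join two classes
  -- of type (1 , 0), two of type (0 , 1), or one of type (1 , 1) and one of type (0 , 0). Since `T`
  -- is a tournament, this leaves `x`, at most one `y` of type (0 , 1), and a uniform rest.
  certificate⇒exceptional : (C : ClassCertificate) → (∃[ i ] σ i ≡ false) → ∀ x → σ x ≡ true →
    ClassCertificate.a C x ≡ true → ClassCertificate.b C x ≡ false → ∃[ y ] Exceptional x y
  certificate⇒exceptional C (e , σe) x σx ax bx = result
    where
    open ClassCertificate C

    clash : ∀ {P : Set} {b c} → b ≡ c → b ≡ true → c ≡ false → P
    clash p q r = contradiction (trans (sym q) (trans p r)) true≢false

    not-arc : ∀ {i j} → a i ≡ true → b j ≡ false → T i j ≡ false
    not-arc {i} {j} p q = ¬-not λ t → clash (arc i j t) p q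

    not-arc′ : ∀ {i j} → a i ≡ false → b j ≡ true → T i j ≡ false
    not-arc′ {i} {j} p q = ¬-not λ t → clash (sym (arc i j t)) q p

    unique⁺ : ∀ {j} → a j ≡ true → b j ≡ false → j ≢ x → ∀ {P : Set} → P
    unique⁺ {j} aj bj j≢x = contradiction (trans (sym (connex j≢x (not-arc aj bx))) (not-arc ax bj)) true≢false

    unique⁻ : ∀ {i j} → a i ≡ false → b i ≡ true → a j ≡ false → b j ≡ true → i ≢ j → ∀ {P : Set} → P
    unique⁻ ai bi aj bj i≢j = contradiction (trans (sym (connex i≢j (not-arc′ ai bj))) (not-arc′ aj bi)) true≢false

    not-both : ∀ {i j} → a i ≡ true → b i ≡ true → a j ≡ false → b j ≡ false → ∀ {P : Set} → P
    not-both {i} {j} ai bi aj bj =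
      contradiction (trans (sym (connex (λ { refl → clash refl ai aj }) (not-arc ai bj))) (not-arc′ aj bi)) true≢false

    D⁺x : D⁺ x ≡ false
    D⁺x = trans (cong (_∧ D⁺ x) (sym ax)) (trans (shift x) (cong (_∧ D⁻ x) bx))

    D⁻-none : ∀ i → (∀ j → T j i ≡ false) → D⁻ i ≡ false
    D⁻-none i z = sum-false λ j → trans (cong (σ j ∧_) (z j)) (∧-zeroʳ (σ j))

    D⁺-none : ∀ i → (∀ j → T i j ≡ false) → D⁺ i ≡ false
    D⁺-none i z = sum-false λ j → trans (cong (σ j ∧_) (z j)) (∧-zeroʳ (σ j))

    -- A class with equal degree parities has the parity of the whole order.
    balanced : ∀ {i} → D⁺ i ≡ D⁻ i → sum σ ≡ σ i
    balanced {i} p = trans (sym (degree-sum tour i)) (trans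
      (cong (λ d → (d xor D⁻ i) xor σ i) p) (cong (_xor σ i) (xor-same (D⁻ i))))

    balanced₁₁ : ∀ {i} → a i ≡ true → b i ≡ true → sum σ ≡ σ i
    balanced₁₁ {i} p q = balanced (trans (cong (_∧ D⁺ i) (sym p)) (trans (shift i) (cong (_∧ D⁻ i) q)))

    not-sink : (∀ w → w ≢ x → T x w ≡ false) → ∀ {P : Set} → P
    not-sink z = clash refl ax (sink x none)
      where
      none : ∀ w → T x w ≡ false
      none w with w ≟ x
      ... | yes refl = proj₁ tour w
      ... | no  w≢x  = z w w≢x

    result : ∃[ y ] Exceptional x y
    result with any? (λ y → (a y Bool.≟ false) ×-dec (b y Bool.≟ true))
    ... | no ∄y = absurd
      where
      uniform : ∀ j → j ≢ x → a j ≡ b j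
      uniform j j≢x with a j in aj | b j in bj
      ... | true  | true  = refl
      ... | false | false = refl
      ... | true  | false = unique⁺ aj bj j≢x
      ... | false | true  = contradiction (j , aj , bj) ∄y
      absurd : _
      absurd with any? (λ z → (¬? (z ≟ x)) ×-dec (a z Bool.≟ false))
      -- All classes but `x` have type (0 , 0), so `x` is a sink, although `a x` is true.
      ... | yes (z , z≢x , az) = not-sink λ w w≢x → not-arc ax (¬-not λ bw →
              not-both (trans (uniform w w≢x) bw) bw az (trans (sym (uniform z z≢x)) az))
      -- All classes but `x` have type (1 , 1). Then `x` is a source with both degree parities 0 and
      -- makes the order odd, while the even class `e` makes it even.
      ... | no ∄z = clash (balanced₁₁ (full e e≢x) (trans (sym (uniform e e≢x)) (full e e≢x))) N σe
        where
        full : ∀ w → w ≢ x → a w ≡ true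
        full w w≢x = ¬-not λ aw → ∄z (w , w≢x , aw)
        into : ∀ w → T w x ≡ false
        into w with w ≟ x
        ... | yes refl = proj₁ tour w
        ... | no  w≢x  = not-arc (full w w≢x) bx
        N : sum σ ≡ true
        N = trans (balanced (trans D⁺x (sym (D⁻-none x into)))) σx
        e≢x : e ≢ x
        e≢x refl = clash refl σx σe
    ... | yes (y , ay , by) = y , found
      where
      x≢y : x ≢ y
      x≢y refl = clash refl ax ay
      uniform : ∀ j → j ≢ x → j ≢ y → a j ≡ b j
      uniform j j≢x j≢y with a j in aj | b j in bj
      ... | true  | true  = refl
      ... | false | false = refl
      ... | true  | false = unique⁺ aj bj j≢x
      ... | false | true  = unique⁻ aj bj ay by j≢y
      D⁻y : D⁻ y ≡ false
      D⁻y = sym (trans (cong (_∧ D⁺ y) (sym ay)) (trans (shift y) (cong (_∧ D⁻ y) by)))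
      σy : σ y ≡ false
      -- Only `x` and `y` contribute to `total`, and `x` already contributes 1.
      σy = cancel (trans (sym (cong₂ _xor_
              (cong₂ _∧_ σx (cong₂ _xor_ ax bx))
              (trans (cong (σ y ∧_) (cong₂ _xor_ ay by)) (∧-identityʳ (σ y)))))
            (trans (sym (sum-pair (λ i → σ i ∧ (a i xor b i)) x≢y off)) total))
        where
        cancel : ∀ {c} → not c ≡ true → c ≡ false
        cancel {false} _ = refl
        off : ∀ i → i ≢ x → i ≢ y → σ i ∧ (a i xor b i) ≡ false
        off i i≢x i≢y = trans (cong (σ i ∧_)
          (trans (cong (_xor b i) (uniform i i≢x i≢y)) (xor-same (b i)))) (∧-zeroʳ (σ i))
      found : Exceptional x y
      found with any? (λ z → (¬? (z ≟ x)) ×-dec ((¬? (z ≟ y)) ×-dec (a z Bool.≟ false)))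
      -- The rest has type (0 , 0). Only the odd class `x` could be an in-neighbour of `y`, so the
      -- vanishing of `D⁻ y` excludes that arc and turns `x` into a sink.
      ... | yes (z , z≢x , z≢y , az) = not-sink out
        where
        others : ∀ w → w ≢ x → w ≢ y → a w ≡ false
        others w w≢x w≢y = ¬-not λ aw →
          not-both aw (trans (sym (uniform w w≢x w≢y)) aw) az (trans (sym (uniform z z≢x z≢y)) az)
        into : ∀ w → w ≢ x → T w y ≡ false
        into w w≢x with w ≟ y
        ... | yes refl = proj₁ tour w
        ... | no  w≢y  = not-arc′ (others w w≢x w≢y) by
        ¬x⇒y : T x y ≡ false
        ¬x⇒y = trans (sym (trans
          (sum-single (λ j → σ j ∧ T j y) x λ j j≢x → trans (cong (σ j ∧_) (into j j≢x)) (∧-zeroʳ (σ j)))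
          (cong (_∧ T x y) σx))) D⁻y
        out : ∀ w → w ≢ x → T x w ≡ false
        out w w≢x with w ≟ y
        ... | yes refl = ¬x⇒y
        ... | no  w≢y  = not-arc ax (trans (sym (uniform w w≢x w≢y)) (others w w≢x w≢y))
      ... | no ∄z = record
        { y⇒x  = y⇒x
        ; x⇒   = λ w w≢x w≢y → connex w≢x (not-arc (full w w≢x w≢y) bx)
        ; ⇒y   = λ w w≢x w≢y → connex (w≢y ∘ sym) (not-arc′ ay (full′ w w≢x w≢y))
        ; even = σy
        ; odds = odds
        ; size = N
        }
        where
        full : ∀ w → w ≢ x → w ≢ y → a w ≡ true
        full w w≢x w≢y = ¬-not λ aw → ∄z (w , w≢x , w≢y , aw)
        full′ : ∀ w → w ≢ x → w ≢ y → b w ≡ true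
        full′ w w≢x w≢y = trans (sym (uniform w w≢x w≢y)) (full w w≢x w≢y)
        into : ∀ w → w ≢ y → T w x ≡ false
        into w w≢y with w ≟ x
        ... | yes refl = proj₁ tour w
        ... | no  w≢x  = not-arc (full w w≢x w≢y) bx
        from : ∀ w → w ≢ x → T y w ≡ false
        from w w≢x with w ≟ y
        ... | yes refl = proj₁ tour w
        ... | no  w≢y  = not-arc′ ay (full′ w w≢x w≢y)
        D⁻x : D⁻ x ≡ false
        D⁻x = trans
          (sum-single (λ j → σ j ∧ T j x) y λ j j≢y → trans (cong (σ j ∧_) (into j j≢y)) (∧-zeroʳ (σ j)))
          (cong (_∧ T y x) σy)
        -- Only the even class `y` can have arcs to `x`, so both degree parities at `x` are 0.
        N : sum σ ≡ true
        N = trans (balanced (trans D⁺x (sym D⁻x))) σx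
        y⇒x : T y x ≡ true
        -- Otherwise `y` is a sink with both degree parities 0, and its even class makes the order
        -- even.
        y⇒x = connex x≢y (¬-not λ x⇒y → clash
          (balanced (trans (D⁺-none y (none x⇒y)) (sym D⁻y))) N σy)
          where
          none : T x y ≡ true → ∀ w → T y w ≡ false
          none x⇒y w with w ≟ x
          ... | yes refl = asym x⇒y
          ... | no  w≢x  = from w w≢x
        odds : ∀ i → i ≢ y → σ i ≡ true
        odds i i≢y with i ≟ x
        ... | yes refl = σx
        ... | no  i≢x  = trans (sym (balanced₁₁ (full i i≢x i≢y) (full′ i i≢x i≢y))) N

flip-certificate : ∀ {n} {T : Fin n → Fin n → Bool} {s} →
  Parity.ClassCertificate T s → Parity.ClassCertificate (flip T) s
flip-certificate {s = s} C = record
  { a = b ; b = a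
  ; arc    = λ i j t → sym (arc j i t)
  ; shift  = λ i → sym (shift i)
  ; sink   = source
  ; source = sink
  ; total  = trans (sum-cong-≗ λ i → cong (odd (s i) ∧_) (xor-comm (b i) (a i))) total
  }
  where open Parity.ClassCertificate C

-- `total` yields an odd class of type (1 , 0) or (0 , 1); the second type is turned into the first
-- by reversing all arcs.
certificate⇒bad : ∀ {n} {T : Fin n → Fin n → Bool} → IsTournament T → ∀ s → 3 < n → (∃[ i ] Even (s i)) →
  Parity.ClassCertificate T s → Bad T s
certificate⇒bad {T = T} tour s n>3 (e , even) C with sum-true _ (Parity.ClassCertificate.total C)
... | x , p with odd (s x) in σx | Parity.ClassCertificate.a C x in ax | Parity.ClassCertificate.b C x in bx
...   | true | true | false =
  exceptional⇒bad tour s n>3 (proj₂ (certificate⇒exceptional tour s C (e , Even⇒¬odd (s e) even) x σx ax bx))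
...   | true | false | true =
  Bad-flip T s (exceptional⇒bad (tournament-flip tour) s n>3 (proj₂
    (certificate⇒exceptional (tournament-flip tour) s (flip-certificate C) (e , Even⇒¬odd (s e) even) x σx bx ax)))

-- Passing between certificates on vertices and on classes.

module Classes {n} (T : Fin n → Fin n → Bool) (s : Fin n → ℕ) (pos : ∀ i → 1 ≤ s i) where

  open Blowup s
  open Coloring T s
  open Parity T s

  rep : ∀ i → Fin (s i)
  rep i = fromℕ< (pos i)

  δ⁺≡D⁺ : ∀ v → δ⁺ v ≡ D⁺ (proj₁ v)
  δ⁺≡D⁺ v = trans (odd-sumEV λ w → arcInd T s v w)
    (trans (⨁-cong λ w → odd-if (arcs v w)) (⨁-class (T (proj₁ v))))

  δ⁻≡D⁻ : ∀ v → δ⁻ v ≡ D⁻ (proj₁ v)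
  δ⁻≡D⁻ v = trans (odd-sumEV λ u → arcInd T s u v)
    (trans (⨁-cong λ u → odd-if (arcs u v)) (⨁-class (λ j → T j (proj₁ v))))

  sumEV≡0 : ∀ (f : V → ℕ) → does (sumEV s f ℕ.≟ 0) ≡ true → ∀ v → f v ≡ 0
  sumEV≡0 f p (i , b) = sumFin≡0 (λ b → f (i , b))
    (sumFin≡0 (λ i → sumFin λ b → f (i , b)) (does-true (sumEV s f ℕ.≟ 0) p) i) b

  sumEV-zero : ∀ (f : V → ℕ) → (∀ v → f v ≡ 0) → does (sumEV s f ℕ.≟ 0) ≡ true
  sumEV-zero f z = dec-true (sumEV s f ℕ.≟ 0) (sumFin-zero λ i → sumFin-zero λ b → z (i , b))

  ι⁺⇒sink : ∀ v → ι⁺ v ≡ true → ∀ j → T (proj₁ v) j ≡ false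
  ι⁺⇒sink v p j = if≡0 (sumEV≡0 (arcInd T s v) p (j , rep j))

  ι⁻⇒source : ∀ v → ι⁻ v ≡ true → ∀ j → T j (proj₁ v) ≡ false
  ι⁻⇒source v p j = if≡0 (sumEV≡0 (λ u → arcInd T s u v) p (j , rep j))

  sink⇒ι⁺ : ∀ v → (∀ j → T (proj₁ v) j ≡ false) → ι⁺ v ≡ true
  sink⇒ι⁺ v z = sumEV-zero (arcInd T s v) λ w → cong (if_then 1 else 0) (z (proj₁ w))

  source⇒ι⁻ : ∀ v → (∀ j → T j (proj₁ v) ≡ false) → ι⁻ v ≡ true
  source⇒ι⁻ v z = sumEV-zero (λ u → arcInd T s u v) λ u → cong (if_then 1 else 0) (z (proj₁ u))

  ⨁-classes : (a b : Fin n → Bool) →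
    ⨁ (a ∘ proj₁) xor ⨁ (b ∘ proj₁) ≡ sum (λ i → σ i ∧ (a i xor b i))
  ⨁-classes a b = trans (cong₂ _xor_ (⨁-class a) (⨁-class b)) (trans
    (sym (∑-distrib-+ (λ i → σ i ∧ a i) _))
    (sum-cong-≗ λ i → sym (∧-distribˡ-xor (σ i) (a i) (b i))))

  fromClasses : ClassCertificate → Certificate
  fromClasses C = record
    { A     = a ∘ proj₁
    ; B     = b ∘ proj₁
    ; arc   = λ u v → arc (proj₁ u) (proj₁ v)
    ; shift = λ v → trans (cong (a (proj₁ v) ∧_) (δ⁺≡D⁺ v))
        (trans (shift (proj₁ v)) (cong (b (proj₁ v) ∧_) (sym (δ⁻≡D⁻ v))))
    ; voidA = λ v p → sink (proj₁ v) (ι⁺⇒sink v p)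
    ; voidB = λ v p → source (proj₁ v) (ι⁻⇒source v p)
    ; total = trans (⨁-classes a b) total
    }
    where open ClassCertificate C

  toClasses : Certificate → ClassCertificate
  toClasses C = record
    { a      = a
    ; b      = b
    ; arc    = λ i j → arc (i , rep i) (j , rep j)
    ; shift  = λ i → trans (cong (a i ∧_) (sym (δ⁺≡D⁺ (i , rep i))))
        (trans (shift (i , rep i)) (cong (b i ∧_) (δ⁻≡D⁻ (i , rep i))))
    ; sink   = λ i z → voidA (i , rep i) (sink⇒ι⁺ (i , rep i) z)
    ; source = λ i z → voidB (i , rep i) (source⇒ι⁻ (i , rep i) z)
    ; total  = trans (sym (⨁-classes a b)) (trans (sym (cong₂ _xor_ (⨁-cong constA) (⨁-cong constB))) total)
    }
    where
    open Certificate C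
    a b : Fin n → Bool
    a i = A (i , rep i)
    b i = B (i , rep i)
    -- All vertices of a class share their out-neighbours, and `A` equals `B` at any one of these;
    -- in a sink class `A` is zero.
    constA : ∀ v → A v ≡ a (proj₁ v)
    constA (i , c) with any? (λ j → T i j Bool.≟ true)
    ... | yes (j , t) = trans (arc (i , c) (j , rep j) t) (sym (arc (i , rep i) (j , rep j) t))
    ... | no ∄j = trans (voidA (i , c) (sink⇒ι⁺ (i , c) none))
        (sym (voidA (i , rep i) (sink⇒ι⁺ (i , rep i) none)))
      where
      none : ∀ j → T i j ≡ false
      none j = ¬-not λ t → ∄j (j , t)
    constB : ∀ v → B v ≡ b (proj₁ v)
    constB (i , c) with any? (λ j → T j i Bool.≟ true)
    ... | yes (j , t) = trans (sym (arc (j , rep j) (i , c) t)) (arc (j , rep j) (i , rep i) t)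
    ... | no ∄j = trans (voidB (i , c) (source⇒ι⁻ (i , c) none))
        (sym (voidB (i , rep i) (source⇒ι⁻ (i , rep i) none)))
      where
      none : ∀ j → T j i ≡ false
      none j = ¬-not λ t → ∄j (j , t)

-- Three colors for bad extended tournaments

two-elements : ∀ m → odd m ≡ false → 1 ≤ m → Σ (Fin m) λ b → ∃[ c ] b ≢ c
two-elements (suc (suc m)) _ _ = zero , suc zero , λ ()

module ThirdColor {n} {T : Fin n → Fin n → Bool} (tour : IsTournament T) (s : Fin n → ℕ)
  (pos : ∀ i → 1 ≤ s i) (n>3 : 3 < n) {x y : Fin n} (E : Parity.Exceptional T s x y) where

  open Tournament tour
  open Parity T s
  open Exceptional E
  open Blowup s
  open Classes T s pos using (rep; ⨁-classes; δ⁺≡D⁺)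
  module Col = Coloring T s
  open Col using (arcs)

  x≢y : x ≢ y
  x≢y = arc⇒≢ y⇒x ∘ sym

  others : ∃[ v ] ∃[ w ] (v ≢ w × (v ≢ x × v ≢ y) × (w ≢ x × w ≢ y))
  others = two-others n>3 x≢y

  -- An even nonempty class keeps a vertex when one is deleted.
  twins : Σ (Fin (s y)) λ b → ∃[ c ] b ≢ c
  twins = two-elements (s y) even (pos y)

  -- `p` is the vertex to delete; `q` lies outside the classes `x` and `y`, hence has an arc to `p`.
  p q : V
  p = y , proj₁ twins
  q = proj₁ others , rep (proj₁ others)

  w = proj₁ others
  w≢x = proj₁ (proj₁ (proj₂ (proj₂ (proj₂ others))))
  w≢y = proj₂ (proj₁ (proj₂ (proj₂ (proj₂ others))))

  -- Deleting p makes all classes odd.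
  R : V → V → Bool
  R u v = arcs u v ∧ (not (is p u) ∧ not (is p v))

  -- With zero shifts, color 0 itself must satisfy every vertex other than `p`; the equations at `p`
  -- are void.
  open Duality R (λ _ → false) (λ _ → false) (is p) (is p)

  is-self : ∀ v → is v v ≡ true
  is-self v = dec-true (v ≟V v) refl

  is-other : ∀ {u v} → v ≢ u → is u v ≡ false
  is-other {u} {v} v≢u = dec-false (u ≟V v) (v≢u ∘ sym)

  r′ : ∀ i → Σ (Fin (s i)) λ b → (i , b) ≢ p
  r′ i with i ≟ y
  ... | yes refl = proj₁ (proj₂ twins) , λ e → proj₂ (proj₂ twins) (sym (,-injectiveʳ e))
  ... | no  i≢y  = rep i , i≢y ∘ cong proj₁

  r : Fin n → V
  r i = i , proj₁ (r′ i)

  out-neighbour : ∀ i → ∃[ j ] T i j ≡ true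
  out-neighbour i with i ≟ x | i ≟ y
  ... | _        | yes refl = x , y⇒x
  ... | yes refl | no  _    = w , x⇒ w w≢x w≢y
  ... | no  i≢x  | no  i≢y  = y , ⇒y i i≢x i≢y

  in-neighbour : ∀ i → ∃[ j ] T j i ≡ true
  in-neighbour i with i ≟ x | i ≟ y
  ... | yes refl | _        = y , y⇒x
  ... | no  _    | yes refl = w , ⇒y w w≢x w≢y
  ... | no  i≢x  | no  i≢y  = x , x⇒ i i≢x i≢y

  -- An arc between two of the remaining classes forces `a x ≡ b y`, and then `a` and `b` agree on
  -- all of these. As `p` is deleted, `y` counts as odd, so `x` and `y` remain; their terms cancel
  -- because `a y ≡ b x`.
  no-certificate : ¬ Certificate
  no-certificate C = true≢false (begin
    true
      ≡⟨ total ⟨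
    ⨁ A xor ⨁ B
      ≡⟨ cong₂ _xor_ (trans (⨁-cong A-class) (⨁-xor (a ∘ proj₁) _)) (trans (⨁-cong B-class) (⨁-xor (b ∘ proj₁) _)) ⟩
    (⨁ (a ∘ proj₁) xor ⨁ (λ v → a y ∧ is p v)) xor (⨁ (b ∘ proj₁) xor ⨁ (λ v → b y ∧ is p v))
      ≡⟨ cong₂ (λ c d → (⨁ (a ∘ proj₁) xor c) xor (⨁ (b ∘ proj₁) xor d)) (⨁-is (λ _ → a y) p) (⨁-is (λ _ → b y) p) ⟩
    (⨁ (a ∘ proj₁) xor a y) xor (⨁ (b ∘ proj₁) xor b y)
      ≡⟨ xor-interchange (⨁ (a ∘ proj₁)) (a y) (⨁ (b ∘ proj₁)) (b y) ⟩
    (⨁ (a ∘ proj₁) xor ⨁ (b ∘ proj₁)) xor (a y xor b y)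
      ≡⟨ cong (_xor (a y xor b y)) (trans (⨁-classes a b) (sum-single (λ i → σ i ∧ (a i xor b i)) x off)) ⟩
    (σ x ∧ (a x xor b x)) xor (a y xor b y)
      ≡⟨ cong₂ _xor_ (cong (_∧ (a x xor b x)) (odds x x≢y)) (cong₂ _xor_ (arc′ y⇒x) (sym ax≡by)) ⟩
    (a x xor b x) xor (b x xor a x)
      ≡⟨ cong ((a x xor b x) xor_) (xor-comm (b x) (a x)) ⟩
    (a x xor b x) xor (a x xor b x)
      ≡⟨ xor-same (a x xor b x) ⟩
    false ∎)
    where
    open Certificate C
    a b : Fin n → Bool
    a i = A (r i)
    b i = B (r i)
    R-arc : ∀ {u v} → u ≢ p → v ≢ p → arcs u v ≡ true → R u v ≡ true
    R-arc u≢p v≢p t = cong₂ _∧_ t (cong₂ _∧_ (cong not (is-other u≢p)) (cong not (is-other v≢p)))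
    arc′ : ∀ {i j} → T i j ≡ true → a i ≡ b j
    arc′ {i} {j} t = arc (r i) (r j) (R-arc (proj₂ (r′ i)) (proj₂ (r′ j)) t)
    -- The last term corrects for `p`, where `A` vanishes instead of taking the value of its class.
    A-class : ∀ v → A v ≡ a (proj₁ v) xor (a y ∧ is p v)
    A-class v with p ≟V v
    ... | yes refl = trans (voidA p (is-self p)) (sym (trans
          (cong (a y xor_) (∧-identityʳ (a y))) (xor-same (a y))))
    ... | no p≢v = trans
          (arc v (r j) (R-arc (p≢v ∘ sym) (proj₂ (r′ j)) t))
          (trans (sym (arc′ t)) (sym (trans (cong (a (proj₁ v) xor_) (∧-zeroʳ (a y))) (xor-identityʳ (a (proj₁ v))))))
      where
      j = proj₁ (out-neighbour (proj₁ v))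
      t = proj₂ (out-neighbour (proj₁ v))
    B-class : ∀ v → B v ≡ b (proj₁ v) xor (b y ∧ is p v)
    B-class v with p ≟V v
    ... | yes refl = trans (voidB p (is-self p)) (sym (trans
          (cong (b y xor_) (∧-identityʳ (b y))) (xor-same (b y))))
    ... | no p≢v = trans
          (sym (arc (r j) v (R-arc (proj₂ (r′ j)) (p≢v ∘ sym) t)))
          (trans (arc′ t) (sym (trans (cong (b (proj₁ v) xor_) (∧-zeroʳ (b y))) (xor-identityʳ (b (proj₁ v))))))
      where
      j = proj₁ (in-neighbour (proj₁ v))
      t = proj₂ (in-neighbour (proj₁ v))
    via : ∀ {v w} → (v ≢ x × v ≢ y) → (w ≢ x × w ≢ y) → T v w ≡ true → a x ≡ b y
    via {v} {w} (v≢x , v≢y) (w≢x , w≢y) t =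
      trans (arc′ (x⇒ w w≢x w≢y)) (trans (sym (arc′ t)) (arc′ (⇒y v v≢x v≢y)))
    ax≡by : a x ≡ b y
    ax≡by with others
    ... | v , w , v≢w , v∉ , w∉ with T v w in eq
    ...   | true  = via v∉ w∉ eq
    ...   | false = via w∉ v∉ (connex v≢w eq)
    off : ∀ i → i ≢ x → σ i ∧ (a i xor b i) ≡ false
    off i i≢x = by (i ≟ y)
      where
      by : Dec (i ≡ y) → σ i ∧ (a i xor b i) ≡ false
      by (yes i≡y) = cong (_∧ (a i xor b i)) (trans (cong σ i≡y) even)
      by (no  i≢y) = trans (cong (σ i ∧_) (trans
        (cong₂ _xor_ (trans (arc′ (⇒y i i≢x i≢y)) (sym ax≡by)) (sym (arc′ (x⇒ i i≢x i≢y))))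
        (xor-same (a x)))) (∧-zeroʳ (σ i))

  -- Color 1 satisfies `p`: its out-degree is odd, all its out-neighbours forming the odd class `x`,
  -- and exactly one arc into it has color 1. Elsewhere color 0 counts `F` on `R`; color 2 takes the
  -- remaining arcs.
  solution⇒3-coloring : Solution (λ _ → true) (λ _ → true) → HasWeakOddColoring T s 3
  solution⇒3-coloring S = φ , λ v → inj₂ (witness v)
    where
    open Solution S
    -- Color 0 is F, color 1 is used on the arcs from p and on the arc q → p only.
    col : V → V → Fin 3
    col u v = if is p u then suc zero else
              if is p v then (if is q u then suc zero else suc (suc zero)) else
              if F u v then zero else suc (suc zero)
    φ : EArc T s → Fin 3
    φ (u , v , _) = col u v
    color-0 : ∀ u v → does (col u v ≟ zero) ≡ (not (is p u) ∧ not (is p v)) ∧ F u v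
    color-0 u v with is p u | is p v | is q u | F u v
    ... | true  | _     | _     | _     = refl
    ... | false | true  | true  | _     = refl
    ... | false | true  | false | _     = refl
    ... | false | false | _     | true  = refl
    ... | false | false | _     | false = refl
    color-0-arc : ∀ u v → odd (arcColInd T s φ u v zero) ≡ R u v ∧ F u v
    color-0-arc u v = trans (Col.odd-arcColInd col u v zero)
      (trans (cong (arcs u v ∧_) (color-0 u v)) (sym (∧-assoc (arcs u v) _ _)))
    strip : ∀ {b} t → true ≡ b xor (t ∧ false) → b ≡ true
    strip {b} t e = sym (trans e (trans (cong (b xor_) (∧-zeroʳ t)) (xor-identityʳ b)))
    p-out : odd (outCol T s φ p (suc zero)) ≡ true
    p-out = begin
      odd (outCol T s φ p (suc zero))
        ≡⟨ Col.odd-outCol φ p (suc zero) ⟩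
      ⨁ (λ v → odd (arcColInd T s φ p v (suc zero)))
        ≡⟨ ⨁-cong (λ v → trans (Col.odd-arcColInd col p v (suc zero)) (trans
             (cong (λ b → arcs p v ∧ does ((if b then suc zero else
               if is p v then (if is q p then suc zero else suc (suc zero)) else
               if F p v then zero else suc (suc zero)) ≟ suc zero)) (is-self p))
             (∧-identityʳ (arcs p v)))) ⟩
      ⨁ (λ v → arcs p v)
        ≡⟨ ⨁-class (T y) ⟩
      D⁺ y
        ≡⟨ out-odd tour s E ⟩
      true ∎
    p-in : odd (inCol T s φ p (suc zero)) ≡ true
    p-in = begin
      odd (inCol T s φ p (suc zero))
        ≡⟨ Col.odd-inCol φ p (suc zero) ⟩
      ⨁ (λ u → odd (arcColInd T s φ u p (suc zero)))
        ≡⟨ ⨁-cong (λ u → trans (Col.odd-arcColInd col u p (suc zero)) (only-q u)) ⟩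
      ⨁ (λ u → arcs u p ∧ is q u)
        ≡⟨ ⨁-is (λ u → arcs u p) q ⟩
      arcs q p
        ≡⟨ ⇒y w w≢x w≢y ⟩
      true ∎
      where
      only-q : ∀ u → arcs u p ∧ does (col u p ≟ suc zero) ≡ arcs u p ∧ is q u
      only-q u with p ≟V u
      ... | yes refl = trans (cong (_∧ true) (proj₁ tour y)) (sym (cong (_∧ is q p) (proj₁ tour y)))
      ... | no  _ rewrite is-self p with is q u
      ...   | true  = refl
      ...   | false = refl
    witness : ∀ v → ∃[ c ] ((outDeg T s v ≢ 0 → Odd (outCol T s φ v c))
                          × (inDeg T s v ≢ 0 → Odd (inCol T s φ v c)))
    witness v with p ≟V v
    ... | yes refl = suc zero , (λ _ → odd⇒Odd (outCol T s φ p (suc zero)) p-out)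
                              , (λ _ → odd⇒Odd (inCol T s φ p (suc zero)) p-in)
    ... | no p≢v = zero
          , (λ _ → odd⇒Odd (outCol T s φ v zero) (trans (Col.odd-outCol φ v zero) (trans
              (⨁-cong (color-0-arc v)) (strip (t v) (out v (is-other (p≢v ∘ sym)))))))
          , (λ _ → odd⇒Odd (inCol T s φ v zero) (trans (Col.odd-inCol φ v zero) (trans
              (⨁-cong λ u → color-0-arc u v) (strip (t v) (inn v (is-other (p≢v ∘ sym)))))))

  3-coloring : HasWeakOddColoring T s 3
  3-coloring with strong-duality
  ... | inj₁ S = solution⇒3-coloring S
  ... | inj₂ C = contradiction C no-certificate

-- Assembling the two cases.

module _ {n} {T : Fin n → Fin n → Bool} (tour : IsTournament T) (s : Fin n → ℕ)
  (pos : ∀ i → 1 ≤ s i) (n>3 : 3 < n) where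

  exceptional-χ : ∀ {x y} → Parity.Exceptional T s x y → HasWeakOddColoring T s 3 × ¬ HasWeakOddColoring T s 2
  exceptional-χ E = ThirdColor.3-coloring tour s pos n>3 E ,
    λ c → weak-duality (coloring⇒solution c) (fromClasses (exceptional⇒certificate tour s n>3 E))
    where
    open Coloring T s
    open Classes T s pos

-- A single in-neighbour becomes a single out-neighbour when all arcs are reversed, and colorings
-- transfer both ways.
bad-χ : ∀ {n} {T : Fin n → Fin n → Bool} → IsTournament T → ∀ s → (∀ i → 1 ≤ s i) → Bad T s →
  HasWeakOddColoring T s 3 × ¬ HasWeakOddColoring T s 2
bad-χ {T = T} tour s pos (n>3 , N , y , sy , si , dom , inj₂ c) =
  exceptional-χ tour s pos n>3 (proj₂ (bad⇒exceptional tour s N y sy si dom c))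
bad-χ {T = T} tour s pos (n>3 , N , y , sy , si , dom , inj₁ c)
  with exceptional-χ (tournament-flip tour) s pos n>3
         (proj₂ (bad⇒exceptional (tournament-flip tour) s N y sy si (λ u w p q → dom w u q p) c))
... | three , ¬two = Coloring.coloring-flip T s three , ¬two ∘ Coloring.coloring-flip (flip T) s

theorem4p4 : ∀ (n : ℕ) (T : Fin n → Fin n → Bool) (s : Fin n → ℕ)
    → IsTournament T
    → 3 < n
    → (∀ i → 1 ≤ s i)
    → (∃[ i ] Even (s i))
    → (Bad T s → χwo≡ T s 3) × (¬ Bad T s → χwo≤ T s 2)
theorem4p4 n T s tour n>3 pos even = three , two
  where
  open Coloring T s
  three : Bad T s → χwo≡ T s 3
  three bad with bad-χ tour s pos bad
  ... | c , ¬two = c , λ { k (s≤s k≤2) → ¬two ∘ coloring-mono k≤2 }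
  two : ¬ Bad T s → χwo≤ T s 2
  two ¬bad with strong-duality
  ... | inj₁ S = 2 , ≤-refl , solution⇒coloring S
  ... | inj₂ C = contradiction (certificate⇒bad tour s n>3 even (Classes.toClasses T s pos C)) ¬bad
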